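{- (Decomposition Lemma) Let $0\le\gamma<10^{ -4}$, $\alpha\ge1$, and let $a\in\mathcal P$ satisfy $\mathrm{LB}(a)\le(0.5+\gamma)\cdot\mathrm{LP}(a)$. Then there exists $\tilde a=(\tilde a_{it})_{i\in U,t\in V}$ with non-negative entries such that - $\tilde a_{it}\le a_{it}$ for all $(i,t)$; - $\mathrm{LP}(\tilde a)\ge(1-\gamma^{1/4})\cdot\mathrm{LP}(a)$; and, furthermore, for every $i\in U$, letting $\tilde a^L_{it}=\tilde a_{it}\cdot\mathbf 1[w_{it}>\alpha\cdot\mathrm{LP}_i(\tilde a)]$, - $\sum_t\tilde a^L_{it}\le\gamma^{1/4}$; - $(0.5-(\alpha+2)\gamma^{1/4})\cdot\mathrm{LP}_i(\tilde a)\le\mathrm{LP}_i(\tilde a^L)\le(0.5+\gamma^{1/4})\cdot\mathrm{LP}_i(\tilde a)$.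
   Context: $U$ and $V$ are finite sets (offline and online vertices), $w_{it}\ge0$ are weights and $p_t\in[0,1]$ probabilities for $i\in U$, $t\in V$. $\mathcal P$ is the set of $x=(x_{it})_{i\in U,t\in V}$ with $x_{it}\ge0$, $\sum_{i\in U}x_{it}\le p_t$ for all $t\in V$, and $\sum_{t\in V}x_{it}\le1$ for all $i\in U$. For $x\in\mathcal P$, $\mathrm{LP}_i(x)=\sum_{t\in V} w_{it}x_{it}$, $\mathrm{LP}(x)=\sum_{i\in U}\mathrm{LP}_i(x)$, $$\mathrm{LB}_i(x)=\max_{\tau\ge 0}\ \sum_{t:\ w_{it}\ge\tau}\ \Big(\prod_{s:\ \tau\le w_{is}<w_{it}}(1-x_{is})\Big)\, x_{it}\, w_{it},$$ and $\mathrm{LB}(x)=\sum_{i\in U}\mathrm{LB}_i(x)$. -}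

module Defs where

open import Level using (Level; suc)
open import Algebra.Bundles using (CommutativeRing; Semiring)
import Algebra.Definitions.RawSemiring as RawSemiringDefinitions
import Algebra.Solver.Ring.NaturalCoefficients.Default as SemiringSolver
import Algebra.Properties.Monoid.Sum as MonoidSum
open import Data.Bool.Base using (Bool; true; false; _∧_; if_then_else_)
open import Data.Fin.Base using (Fin)
open import Data.List.Base using (filter; tabulate)
import Data.List.Extrema as Extrema
open import Data.List.Membership.Propositional.Properties
  using (∈-filter⁺; ∈-tabulate⁺)
import Data.List.Relation.Unary.All as All
open import Data.List.Relation.Unary.All.Properties using (all-filter; filter⁺; tabulate⁺)
open import Data.Nat.Base using (ℕ)
open import Data.Product.Base using (∃; _×_; _,_; proj₁; proj₂)
open import Data.Sum.Base using (inj₁; inj₂)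
open import Function.Base using (_∘_; id)
open import Function.Bundles using (_⇔_; mk⇔)
open import Relation.Binary.Bundles using (DecTotalOrder; StrictTotalOrder)
open import Relation.Binary.Core using (Rel)
open import Relation.Binary.PropositionalEquality.Core as ≡ using (_≡_)
import Relation.Binary.Properties.DecTotalOrder as DecTotalOrderProperties
import Relation.Binary.Reasoning.PartialOrder as PartialOrderReasoning
open import Relation.Binary.Structures using (IsDecTotalOrder)
open import Relation.Nullary.Decidable.Core
  using (Dec; does; yes; no; _×-dec_)
open import Relation.Nullary.Decidable using (does-⇔)
open import Relation.Nullary.Negation.Core using (¬_; contradiction)
open import Relation.Unary using (Pred; Decidable)

-- The real numbers, given axiomatically: agda-stdlib has no construction of
-- ℝ.  Classically a Dedekind-complete ordered field is unique up to
-- isomorphism, so quantifying over this record is quantifying over "the"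
-- field of reals.  Decidability of the order reflects classical reasoning.
-- The value of 0# ⁻¹ is left unspecified.

record CompleteOrderedField (ℓ : Level) : Set (suc ℓ) where
  infix 4 _≤_
  infix 9 _⁻¹
  field
    commutativeRing : CommutativeRing ℓ ℓ

  open CommutativeRing commutativeRing public
    renaming (refl to ≈-refl; sym to ≈-sym; trans to ≈-trans)

  field
    1≉0         : ¬ (1# ≈ 0#)
    _⁻¹         : Carrier → Carrier
    ⁻¹-inverseʳ : ∀ x → ¬ (x ≈ 0#) → x * x ⁻¹ ≈ 1#

    _≤_             : Rel Carrier ℓ
    isDecTotalOrder : IsDecTotalOrder _≈_ _≤_
    +-monoʳ-≤       : ∀ z {x y} → x ≤ y → z + x ≤ z + y
    *-nonNeg        : ∀ {x y} → 0# ≤ x → 0# ≤ y → 0# ≤ x * y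

  IsUpperBound : Pred Carrier ℓ → Carrier → Set ℓ
  IsUpperBound P b = ∀ x → P x → x ≤ b

  IsSupremum : Pred Carrier ℓ → Carrier → Set ℓ
  IsSupremum P s = IsUpperBound P s × (∀ b → IsUpperBound P b → s ≤ b)

  field
    complete : (P : Pred Carrier ℓ) → ∃ P → ∃ (IsUpperBound P) → ∃ (IsSupremum P)

  IsMaximum : Pred Carrier ℓ → Carrier → Set ℓ
  IsMaximum P m = P m × IsUpperBound P m

  decTotalOrder : DecTotalOrder ℓ ℓ ℓ
  decTotalOrder = record { isDecTotalOrder = isDecTotalOrder }

  open DecTotalOrder decTotalOrder public
    using ( _≟_; _≤?_; total; antisym; totalOrder; poset; ≤-respˡ-≈; ≤-respʳ-≈)
    renaming ( refl to ≤-refl; reflexive to ≤-reflexive; trans to ≤-trans )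

  open DecTotalOrderProperties decTotalOrder public
    using ( _<_; <-strictTotalOrder; <-irrefl; <-trans; <⇒≉; <⇒≱; ≤⇒≯; ≤∧≉⇒<
          ; ≰⇒>; ≰⇒≥; ≮⇒≥; <-compare)

  open StrictTotalOrder <-strictTotalOrder public using (_<?_)

  open RawSemiringDefinitions (Semiring.rawSemiring semiring) public using (_^_)
    renaming (_×_ to _×ᴺ_)

  fromℕ : ℕ → Carrier
  fromℕ n = n ×ᴺ 1#

  ½ : Carrier
  ½ = fromℕ 2 ⁻¹

  10⁻⁴ : Carrier
  10⁻⁴ = (fromℕ 10 ^ 4) ⁻¹

  open MonoidSum +-monoid public using (sum; sum-cong-≋)
  open MonoidSum *-monoid public using () renaming (sum to product; sum-cong-≋ to product-cong-≋)

  sumOver : ∀ {n p} {P : Pred (Fin n) p} → Decidable P → (Fin n → Carrier) → Carrier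
  sumOver P? f = sum λ t → if does (P? t) then f t else 0#

  productOver : ∀ {n p} {P : Pred (Fin n) p} → Decidable P → (Fin n → Carrier) → Carrier
  productOver P? f = product λ t → if does (P? t) then f t else 1#

  𝟙 : ∀ {p} {P : Set p} → Dec P → Carrier
  𝟙 P? = if does P? then 1# else 0#

module RealProperties {ℓ} (ℝ : CompleteOrderedField ℓ) where
  open CompleteOrderedField ℝ
  open PartialOrderReasoning poset
  open SemiringSolver commutativeSemiring using (solve; _:=_; _:+_; _:*_; con)

  +-monoˡ-≤ : ∀ z {x y} → x ≤ y → x + z ≤ y + z
  +-monoˡ-≤ z {x} {y} x≤y = begin
    x + z ≈⟨ +-comm x z ⟩
    z + x ≤⟨ +-monoʳ-≤ z x≤y ⟩
    z + y ≈⟨ +-comm z y ⟩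
    y + z ∎

  +-mono-≤ : ∀ {x y u v} → x ≤ y → u ≤ v → x + u ≤ y + v
  +-mono-≤ x≤y u≤v = ≤-trans (+-monoˡ-≤ _ x≤y) (+-monoʳ-≤ _ u≤v)

  x-y+y≈x : ∀ x y → (x - y) + y ≈ x
  x-y+y≈x x y = begin-equality
    (x - y) + y     ≈⟨ +-assoc x (- y) y ⟩
    x + (- y + y)   ≈⟨ +-congˡ (-‿inverseˡ y) ⟩
    x + 0#          ≈⟨ +-identityʳ x ⟩
    x               ∎

  +-cancelˡ-≤ : ∀ z {x y} → z + x ≤ z + y → x ≤ y
  +-cancelˡ-≤ z {x} {y} p = begin
    x               ≈⟨ lemma x ⟨
    - z + (z + x)   ≤⟨ +-monoʳ-≤ (- z) p ⟩
    - z + (z + y)   ≈⟨ lemma y ⟩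
    y               ∎
    where
    lemma : ∀ u → - z + (z + u) ≈ u
    lemma u = begin-equality
      - z + (z + u) ≈⟨ +-assoc (- z) z u ⟨
      (- z + z) + u ≈⟨ +-congʳ (-‿inverseˡ z) ⟩
      0# + u        ≈⟨ +-identityˡ u ⟩
      u             ∎

  +-cancelʳ-≤ : ∀ z {x y} → x + z ≤ y + z → x ≤ y
  +-cancelʳ-≤ z {x} {y} p = +-cancelˡ-≤ z (begin
    z + x ≈⟨ +-comm z x ⟩
    x + z ≤⟨ p ⟩
    y + z ≈⟨ +-comm y z ⟩
    z + y ∎)

  x≤y⇒0≤y-x : ∀ {x y} → x ≤ y → 0# ≤ y - x
  x≤y⇒0≤y-x {x} {y} x≤y = +-cancelʳ-≤ x (begin
    0# + x      ≈⟨ +-identityˡ x ⟩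
    x           ≤⟨ x≤y ⟩
    y           ≈⟨ x-y+y≈x y x ⟨
    (y - x) + x ∎)

  x≤x+y : ∀ x {y} → 0# ≤ y → x ≤ x + y
  x≤x+y x {y} 0≤y = begin
    x       ≈⟨ +-identityʳ x ⟨
    x + 0#  ≤⟨ +-monoʳ-≤ x 0≤y ⟩
    x + y   ∎

  +-nonNeg : ∀ {x y} → 0# ≤ x → 0# ≤ y → 0# ≤ x + y
  +-nonNeg {x} 0≤x 0≤y = ≤-trans 0≤x (x≤x+y x 0≤y)

  *-monoʳ-≤ : ∀ {z x y} → 0# ≤ z → x ≤ y → z * x ≤ z * y
  *-monoʳ-≤ {z} {x} {y} 0≤z x≤y = begin
    z * x               ≤⟨ x≤x+y (z * x) (*-nonNeg 0≤z (x≤y⇒0≤y-x x≤y)) ⟩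
    z * x + z * (y - x) ≈⟨ solve 3 (λ z x d → z :* x :+ z :* d := z :* (d :+ x)) ≈-refl z x (y - x) ⟩
    z * ((y - x) + x)   ≈⟨ *-congˡ (x-y+y≈x y x) ⟩
    z * y               ∎

  *-mono-≤ : ∀ {x y u v} → 0# ≤ x → 0# ≤ v → x ≤ y → u ≤ v → x * u ≤ y * v
  *-mono-≤ {x} {y} {u} {v} 0≤x 0≤v x≤y u≤v = begin
    x * u ≤⟨ *-monoʳ-≤ 0≤x u≤v ⟩
    x * v ≈⟨ *-comm x v ⟩
    v * x ≤⟨ *-monoʳ-≤ 0≤v x≤y ⟩
    v * y ≈⟨ *-comm v y ⟩
    y * v ∎

  x*y≈0⇒x≈0 : ∀ {x y} → ¬ (y ≈ 0#) → x * y ≈ 0# → x ≈ 0#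
  x*y≈0⇒x≈0 {x} {y} y≉0 xy≈0 = begin-equality
    x               ≈⟨ *-identityʳ x ⟨
    x * 1#          ≈⟨ *-congˡ (⁻¹-inverseʳ y y≉0) ⟨
    x * (y * y ⁻¹)  ≈⟨ *-assoc x y (y ⁻¹) ⟨
    x * y * y ⁻¹    ≈⟨ *-congʳ xy≈0 ⟩
    0# * y ⁻¹       ≈⟨ zeroˡ (y ⁻¹) ⟩
    0#              ∎

  0≤x² : ∀ x → 0# ≤ x * x
  0≤x² x with total 0# x
  ... | inj₁ 0≤x = *-nonNeg 0≤x 0≤x
  ... | inj₂ x≤0 = begin
    0#                  ≤⟨ *-nonNeg 0≤-x 0≤-x ⟩
    y * y               ≈⟨ +-identityʳ (y * y) ⟨
    y * y + 0#          ≈⟨ +-congˡ (≈-trans (*-congˡ y+x≈0) (zeroʳ x)) ⟨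
    y * y + x * (y + x) ≈⟨ solve 2 (λ y x → y :* y :+ x :* (y :+ x) := x :* x :+ y :* (y :+ x)) ≈-refl y x ⟩
    x * x + y * (y + x) ≈⟨ +-congˡ (≈-trans (*-congˡ y+x≈0) (zeroʳ y)) ⟩
    x * x + 0#          ≈⟨ +-identityʳ (x * x) ⟩
    x * x               ∎
    where
    y = 0# - x
    0≤-x : 0# ≤ y
    0≤-x = x≤y⇒0≤y-x x≤0
    y+x≈0 : y + x ≈ 0#
    y+x≈0 = x-y+y≈x 0# x

  0≤1 : 0# ≤ 1#
  0≤1 = ≤-respʳ-≈ (*-identityˡ 1#) (0≤x² 1#)

  ⁻¹-nonNeg : ∀ {x} → 0# ≤ x → ¬ (x ≈ 0#) → 0# ≤ x ⁻¹
  ⁻¹-nonNeg {x} 0≤x x≉0 = begin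
    0#                    ≤⟨ *-nonNeg 0≤x (0≤x² (x ⁻¹)) ⟩
    x * (x ⁻¹ * x ⁻¹)     ≈⟨ *-assoc x (x ⁻¹) (x ⁻¹) ⟨
    x * x ⁻¹ * x ⁻¹       ≈⟨ *-congʳ (⁻¹-inverseʳ x x≉0) ⟩
    1# * x ⁻¹             ≈⟨ *-identityˡ (x ⁻¹) ⟩
    x ⁻¹                  ∎

  x²≤y²⇒x≤y : ∀ {x y} → 0# ≤ x → 0# ≤ y → x * x ≤ y * y → x ≤ y
  x²≤y²⇒x≤y {x} {y} 0≤x 0≤y x²≤y² with x ≤? y
  ... | yes x≤y = x≤y
  ... | no  x≰y = ≤-reflexive (≈-trans x≈0 (antisym 0≤y (≤-trans y≤x (≤-reflexive x≈0))))
    where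
    y≤x = ≰⇒≥ x≰y
    d = x - y
    d≉0 : ¬ (d ≈ 0#)
    d≉0 d≈0 = x≰y (≤-reflexive (≈-trans (≈-sym (x-y+y≈x x y)) (≈-trans (+-congʳ d≈0) (+-identityˡ y))))
    -- 0 ≤ d x ≤ d x + d y = x² - y² ≤ 0
    x*d≤0 : x * d ≤ 0#
    x*d≤0 = +-cancelˡ-≤ (y * y) (begin
      y * y + x * d           ≤⟨ x≤x+y _ (*-nonNeg 0≤y (x≤y⇒0≤y-x y≤x)) ⟩
      (y * y + x * d) + y * d ≈⟨ solve 3 (λ x y d → (y :* y :+ x :* d) :+ y :* d := y :* (d :+ y) :+ x :* d) ≈-refl x y d ⟩
      y * (d + y) + x * d     ≈⟨ +-congʳ (*-congˡ (x-y+y≈x x y)) ⟩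
      y * x + x * d           ≈⟨ solve 3 (λ x y d → y :* x :+ x :* d := x :* (d :+ y)) ≈-refl x y d ⟩
      x * (d + y)             ≈⟨ *-congˡ (x-y+y≈x x y) ⟩
      x * x                   ≤⟨ x²≤y² ⟩
      y * y                   ≈⟨ +-identityʳ _ ⟨
      y * y + 0#              ∎)
    x≈0 : x ≈ 0#
    x≈0 = x*y≈0⇒x≈0 d≉0 (antisym x*d≤0 (*-nonNeg 0≤x (x≤y⇒0≤y-x y≤x)))

  -- s² < y leads to a contradiction by enlarging s by d / (2s + 1 + d), where
  -- d = y - s²; s² > y by decreasing s by (s² - y) / 2s.

  sqrt : ∀ y → 0# ≤ y → ∃ λ r → 0# ≤ r × r * r ≈ y
  sqrt y 0≤y = s , 0≤s , antisym s²≤y y≤s²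
    where
    S : Carrier → Set ℓ
    S z = 0# ≤ z × z * z ≤ y

    0∈S : S 0#
    0∈S = ≤-refl , ≤-respˡ-≈ (≈-sym (zeroˡ 0#)) 0≤y

    1+y-bound : IsUpperBound S (1# + y)
    1+y-bound z (0≤z , z²≤y) = x²≤y²⇒x≤y 0≤z (+-nonNeg 0≤1 0≤y) (begin
      z * z                           ≤⟨ z²≤y ⟩
      y                               ≤⟨ x≤x+y y (+-nonNeg (+-nonNeg 0≤1 0≤y) (*-nonNeg 0≤y 0≤y)) ⟩
      y + (1# + y + y * y)            ≈⟨ solve 1 (λ y → y :+ (con 1 :+ y :+ y :* y) := (con 1 :+ y) :* (con 1 :+ y)) (≈-refl) y ⟩
      (1# + y) * (1# + y)             ∎)

    sup = complete S (0# , 0∈S) (1# + y , 1+y-bound)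
    s = proj₁ sup
    s-bound = proj₁ (proj₂ sup)
    s-least = proj₂ (proj₂ sup)

    0≤s : 0# ≤ s
    0≤s = s-bound 0# 0∈S

    module Quotient {d k} (0≤d : 0# ≤ d) (0≤k : 0# ≤ k) (k≉0 : ¬ (k ≈ 0#)) where
      ε = d * k ⁻¹
      0≤ε : 0# ≤ ε
      0≤ε = *-nonNeg 0≤d (⁻¹-nonNeg 0≤k k≉0)
      ε*k≈d : ε * k ≈ d
      ε*k≈d = begin-equality
        d * k ⁻¹ * k    ≈⟨ solve 3 (λ d i k → d :* i :* k := d :* (k :* i)) ≈-refl d (k ⁻¹) k ⟩
        d * (k * k ⁻¹)  ≈⟨ *-congˡ (⁻¹-inverseʳ k k≉0) ⟩
        d * 1#          ≈⟨ *-identityʳ d ⟩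
        d               ∎
      ε≤0⇒d≤0 : ε ≤ 0# → d ≤ 0#
      ε≤0⇒d≤0 ε≤0 = begin
        d        ≈⟨ ε*k≈d ⟨
        ε * k    ≈⟨ *-congʳ (antisym ε≤0 0≤ε) ⟩
        0# * k   ≈⟨ zeroˡ k ⟩
        0#       ∎

    u-v≤0⇒u≤v : ∀ {u v} → u - v ≤ 0# → u ≤ v
    u-v≤0⇒u≤v {u} {v} p = begin
      u           ≈⟨ x-y+y≈x u v ⟨
      (u - v) + v ≤⟨ +-monoˡ-≤ v p ⟩
      0# + v      ≈⟨ +-identityˡ v ⟩
      v           ∎

    y≤s² : y ≤ s * s
    y≤s² with y ≤? s * s
    ... | yes p = p
    ... | no  y≰s² = u-v≤0⇒u≤v (ε≤0⇒d≤0 (+-cancelˡ-≤ s (begin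
        s + ε ≤⟨ s-bound (s + ε) (+-nonNeg 0≤s 0≤ε , [s+ε]²≤y) ⟩
        s     ≈⟨ +-identityʳ s ⟨
        s + 0# ∎)))
      where
      d = y - s * s
      0≤d : 0# ≤ d
      0≤d = x≤y⇒0≤y-x (≰⇒≥ y≰s²)
      k₀ = (s + s) + d
      0≤k₀ : 0# ≤ k₀
      0≤k₀ = +-nonNeg (+-nonNeg 0≤s 0≤s) 0≤d
      0≤k : 0# ≤ 1# + k₀
      0≤k = +-nonNeg 0≤1 0≤k₀
      k≉0 : ¬ (1# + k₀ ≈ 0#)
      k≉0 k≈0 = 1≉0 (antisym (≤-trans (x≤x+y 1# 0≤k₀) (≤-reflexive k≈0)) 0≤1)
      open Quotient 0≤d 0≤k k≉0
      ε≤1 : ε ≤ 1#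
      ε≤1 with ε ≤? 1#
      ... | yes p = p
      ... | no ε≰1 = +-cancelʳ-≤ k₀ (begin
        ε + k₀            ≤⟨ +-monoʳ-≤ ε (≤-respˡ-≈ (*-identityˡ k₀) (*-mono-≤ 0≤1 0≤k₀ (≰⇒≥ ε≰1) ≤-refl)) ⟩
        ε + ε * k₀        ≈⟨ solve 2 (λ e k → e :+ e :* k := e :* (con 1 :+ k)) ≈-refl ε k₀ ⟩
        ε * (1# + k₀)     ≈⟨ ε*k≈d ⟩
        d                 ≤⟨ x≤x+y d (+-nonNeg 0≤1 (+-nonNeg 0≤s 0≤s)) ⟩
        d + (1# + (s + s)) ≈⟨ solve 2 (λ d s → d :+ (con 1 :+ (s :+ s)) := con 1 :+ ((s :+ s) :+ d)) ≈-refl d s ⟩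
        1# + k₀           ∎)
      [s+ε]²≤y : (s + ε) * (s + ε) ≤ y
      [s+ε]²≤y = begin
        (s + ε) * (s + ε)         ≈⟨ solve 2 (λ s e → (s :+ e) :* (s :+ e) := s :* s :+ (e :* (s :+ s) :+ e :* e)) ≈-refl s ε ⟩
        s * s + (ε * (s + s) + ε * ε)
          ≤⟨ +-monoʳ-≤ _ (+-monoʳ-≤ _ (*-monoʳ-≤ 0≤ε ε≤1)) ⟩
        s * s + (ε * (s + s) + ε * 1#)
          ≤⟨ +-monoʳ-≤ _ (x≤x+y _ (*-nonNeg 0≤ε 0≤d)) ⟩
        s * s + ((ε * (s + s) + ε * 1#) + ε * d)
          ≈⟨ solve 3 (λ s e d → s :* s :+ ((e :* (s :+ s) :+ e :* con 1) :+ e :* d)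
                             := e :* (con 1 :+ ((s :+ s) :+ d)) :+ s :* s) ≈-refl s ε d ⟩
        ε * (1# + k₀) + s * s     ≈⟨ +-congʳ ε*k≈d ⟩
        d + s * s                 ≈⟨ x-y+y≈x y (s * s) ⟩
        y                         ∎

    s²≤y : s * s ≤ y
    s²≤y with s * s ≤? y
    ... | yes p = p
    ... | no  s²≰y = u-v≤0⇒u≤v (ε≤0⇒d≤0 (+-cancelˡ-≤ b (begin
        b + ε   ≈⟨ x-y+y≈x s ε ⟩
        s       ≤⟨ s-least b b-bound ⟩
        b       ≈⟨ +-identityʳ b ⟨
        b + 0#  ∎)))
      where
      d = s * s - y
      0≤d : 0# ≤ d
      0≤d = x≤y⇒0≤y-x (≰⇒≥ s²≰y)
      s≉0 : ¬ (s ≈ 0#)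
      s≉0 s≈0 = s²≰y (≤-respˡ-≈ (≈-sym (≈-trans (*-congʳ s≈0) (zeroˡ s))) 0≤y)
      2s≉0 : ¬ (s + s ≈ 0#)
      2s≉0 2s≈0 = s≉0 (antisym (≤-trans (x≤x+y s 0≤s) (≤-reflexive 2s≈0)) 0≤s)
      open Quotient 0≤d (+-nonNeg 0≤s 0≤s) 2s≉0
      b = s - ε
      b+ε≈s : b + ε ≈ s
      b+ε≈s = x-y+y≈x s ε
      ε≤s : ε ≤ s
      ε≤s with ε ≤? s
      ... | yes p = p
      ... | no ε≰s = contradiction (antisym (+-cancelˡ-≤ (s * s) (begin
          s * s + s * s      ≈⟨ distribˡ s s s ⟨
          s * (s + s)        ≤⟨ *-mono-≤ 0≤s (+-nonNeg 0≤s 0≤s) (≰⇒≥ ε≰s) ≤-refl ⟩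
          ε * (s + s)        ≈⟨ ε*k≈d ⟩
          d                  ≤⟨ x≤x+y d 0≤y ⟩
          d + y              ≈⟨ x-y+y≈x (s * s) y ⟩
          s * s              ≈⟨ +-identityʳ _ ⟨
          s * s + 0#         ∎)) (0≤x² s)) (s≉0 ∘ x*y≈0⇒x≈0 s≉0)
      0≤b : 0# ≤ b
      0≤b = x≤y⇒0≤y-x ε≤s
      y≤b² : y ≤ b * b
      y≤b² = +-cancelʳ-≤ d (begin
        y + d                     ≈⟨ +-comm y d ⟩
        d + y                     ≈⟨ x-y+y≈x (s * s) y ⟩
        s * s                     ≈⟨ *-cong b+ε≈s b+ε≈s ⟨
        (b + ε) * (b + ε)         ≤⟨ x≤x+y _ (0≤x² ε) ⟩
        (b + ε) * (b + ε) + ε * ε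
          ≈⟨ solve 2 (λ b e → (b :+ e) :* (b :+ e) :+ e :* e := b :* b :+ e :* ((b :+ e) :+ (b :+ e))) ≈-refl b ε ⟩
        b * b + ε * ((b + ε) + (b + ε)) ≈⟨ +-congˡ (*-congˡ (+-cong b+ε≈s b+ε≈s)) ⟩
        b * b + ε * (s + s)       ≈⟨ +-congˡ ε*k≈d ⟩
        b * b + d                 ∎)
      b-bound : IsUpperBound S b
      b-bound z (0≤z , z²≤y) = x²≤y²⇒x≤y 0≤z 0≤b (≤-trans z²≤y y≤b²)

  fourthRoot : ∀ x → 0# ≤ x → ∃ λ r → 0# ≤ r × r ^ 4 ≈ x
  fourthRoot x 0≤x with sqrt x 0≤x
  ... | q , 0≤q , q²≈x with sqrt q 0≤q
  ...   | r , 0≤r , r²≈q = r , 0≤r , (begin-equality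
    r ^ 4             ≈⟨ solve 1 (λ r → r :* (r :* (r :* (r :* con 1))) := (r :* r) :* (r :* r)) ≈-refl r ⟩
    (r * r) * (r * r) ≈⟨ *-cong r²≈q r²≈q ⟩
    q * q             ≈⟨ q²≈x ⟩
    x                 ∎)

record Instance {ℓ} (ℝ : CompleteOrderedField ℓ) : Set ℓ where
  open CompleteOrderedField ℝ
  field
    ∣U∣ ∣V∣ : ℕ

  U : Set
  U = Fin ∣U∣

  V : Set
  V = Fin ∣V∣

  field
    w   : U → V → Carrier
    p   : V → Carrier
    0≤w : ∀ i t → 0# ≤ w i t
    0≤p : ∀ t → 0# ≤ p t
    p≤1 : ∀ t → p t ≤ 1#

module OnlineMatching {ℓ} {ℝ : CompleteOrderedField ℓ} (G : Instance ℝ) where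
  open CompleteOrderedField ℝ
  open RealProperties ℝ
  open Instance G
  open PartialOrderReasoning poset
  open Extrema totalOrder using
    (argmax; argmax-all; f[⊥]≤f[argmax]; f[xs]≤f[argmax]; max; ⊥≤max; xs≤max; min; min≤xs; v≤min⁺; argmin-all)

  record 𝒫 (x : U → V → Carrier) : Set ℓ where
    field
      nonNeg  : ∀ i t → 0# ≤ x i t
      online  : ∀ t → sum (λ i → x i t) ≤ p t
      offline : ∀ i → sum (λ t → x i t) ≤ 1#

  LPᵢ : (U → V → Carrier) → U → Carrier
  LPᵢ x i = sum λ t → w i t * x i t

  LP : (U → V → Carrier) → Carrier
  LP x = sum (LPᵢ x)

  thresholdValue : (U → V → Carrier) → U → Carrier → Carrier
  thresholdValue x i τ =
    sumOver (λ t → τ ≤? w i t) λ t →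
      productOver (λ s → (τ ≤? w i s) ×-dec (w i s <? w i t)) (λ s → 1# - x i s)
        * x i t * w i t

  thresholdValues : (U → V → Carrier) → U → Pred Carrier ℓ
  thresholdValues x i v = ∃ λ τ → 0# ≤ τ × v ≈ thresholdValue x i τ

  -- thresholdValue x i τ depends on τ only through {t : τ ≤ w i t}, so the
  -- maximum over τ ≥ 0 is attained at some w i t or above all of them.

  thresholdValue-cong : ∀ x i {τ σ} → (∀ t → τ ≤ w i t ⇔ σ ≤ w i t) →
                        thresholdValue x i τ ≈ thresholdValue x i σ
  thresholdValue-cong x i {τ} {σ} eq = sum-cong-≋ λ t →
    ≈-trans
      (if-cong (same t))
      (if-congᵗ (does (σ ≤? w i t)) (*-congʳ (*-congʳ (product-cong-≋ λ s →
        if-cong (≡.cong (_∧ does (w i s <? w i t)) (same s))))))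
    where
    same : ∀ t → does (τ ≤? w i t) ≡ does (σ ≤? w i t)
    same t = does-⇔ (eq t) (τ ≤? w i t) (σ ≤? w i t)
    if-cong : ∀ {b c : Bool} {u v} → b ≡ c → (if b then u else v) ≈ (if c then u else v)
    if-cong ≡.refl = ≈-refl
    if-congᵗ : ∀ (b : Bool) {u u′ v} → u ≈ u′ → (if b then u else v) ≈ (if b then u′ else v)
    if-congᵗ true  p = p
    if-congᵗ false p = ≈-refl

  maxThresholdValue : ∀ x i → ∃ (IsMaximum (thresholdValues x i))
  maxThresholdValue x i = f τ* , (τ* , 0≤τ* , ≈-refl) , bound
    where
    f = thresholdValue x i
    ws = tabulate (w i)
    top = 1# + max 0# ws
    τ* = argmax f top ws

    0≤top : 0# ≤ top
    0≤top = +-nonNeg 0≤1 (⊥≤max 0# ws)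

    top≰w : ∀ t → ¬ (top ≤ w i t)
    top≰w t top≤w = 1≉0 (antisym (+-cancelʳ-≤ (max 0# ws) (begin
      1# + max 0# ws ≤⟨ top≤w ⟩
      w i t          ≤⟨ All.lookup (xs≤max 0# ws) (∈-tabulate⁺ t) ⟩
      max 0# ws      ≈⟨ +-identityˡ _ ⟨
      0# + max 0# ws ∎)) 0≤1)

    0≤τ* : 0# ≤ τ*
    0≤τ* = argmax-all f {P = 0# ≤_} 0≤top (tabulate⁺ (0≤w i))

    f[top]≤ : f top ≤ f τ*
    f[top]≤ = f[⊥]≤f[argmax] {f = f} top ws

    f≤ : ∀ τ → f τ ≤ f τ*
    f≤ τ with τ ≤? top
    ... | no τ≰top = ≤-respˡ-≈ (thresholdValue-cong x i λ t →
            mk⇔ (λ top≤w → contradiction top≤w (top≰w t))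
                (λ τ≤w → contradiction (≤-trans (≰⇒≥ τ≰top) τ≤w) (top≰w t)))
            f[top]≤
    ... | yes τ≤top = ≤-respˡ-≈ (thresholdValue-cong x i λ t →
            mk⇔ (≤-trans τ≤c)
                (λ τ≤w → All.lookup (min≤xs top above) (∈-filter⁺ (τ ≤?_) (∈-tabulate⁺ t) τ≤w)))
            f[c]≤
      where
      above = filter (τ ≤?_) ws
      c = min top above
      τ≤c : τ ≤ c
      τ≤c = v≤min⁺ τ≤top (all-filter (τ ≤?_) ws)
      f[c]≤ : f c ≤ f τ*
      f[c]≤ = argmin-all id {P = λ v → f v ≤ f τ*} f[top]≤
                (filter⁺ (τ ≤?_) (f[xs]≤f[argmax] {f = f} top ws))

    bound : IsUpperBound (thresholdValues x i) (f τ*)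
    bound v (τ , 0≤τ , v≈fτ) = ≤-respˡ-≈ (≈-sym v≈fτ) (f≤ τ)

  LBᵢ : (U → V → Carrier) → U → Carrier
  LBᵢ x i = proj₁ (maxThresholdValue x i)

  LB : (U → V → Carrier) → Carrier
  LB x = sum (LBᵢ x)

  -- The matrix x^L; the threshold of row i uses LPᵢ of x itself.

  large : Carrier → (U → V → Carrier) → U → V → Carrier
  large α x i t = x i t * 𝟙 (α * LPᵢ x i <? w i t)

{-# OPTIONS --safe #-}

-- Put ε = γ^¼ and δ = ε³.  Rows with LBᵢ > (½ + δ) LPᵢ are zeroed; as LBᵢ ≥ ½ LPᵢ
-- always, they carry at most the fraction γ / δ = ε of LP.  The other rows need
-- no change.
--
-- In such a row write M = LBᵢ and L = LPᵢ, let reward A be the threshold sum of an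
-- upper set A of weights, and let deficit t = M - reward (above t) ≥ 0.  If the
-- elements of A are tried from the lightest, conditioning on the heaviest success
-- in A ∖ B gives, for upper sets B ⊆ A,
--   reward B + value (A ∖ B) ≤ reward A + ∑_{t ∈ A ∖ B} x t * reward (above t).
-- With A everything and B empty, ∑ x t * deficit t ≤ 2 M - L ≤ 2 δ L.
--
-- Let T be the large elements, of mass q and value F.
--  * Weights in T exceed L, so the exchange inequality for B = above t makes the
--    deficit grow at rate at least L - M ≥ (½ - δ) L along T; hence
--    (½ - δ) L q² / 2 ≤ 2 δ L, and q ≤ ε.
--  * A = T and B empty give F ≤ M (1 + q).
--  * reward (above t) ≤ F + α L * mass (above t), so the heaviest ε² of the mass
--    has deficit at least M - F - α L ε², which is therefore at most 2 ε L.

module Submission where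

open import Defs
open import Algebra.Bundles using (CommutativeRing; RawRing)
import Algebra.Properties.CommutativeMonoid.Sum as CommutativeMonoidSum
import Algebra.Properties.Ring as RingProperties
import Algebra.Properties.AbelianGroup as AbelianGroupProperties
import Algebra.Properties.Semiring.Mult.TCOptimised as SemiringMult
import Algebra.Properties.Semiring.Sum as SemiringSum
import Algebra.Solver.Ring as RingSolver
open import Algebra.Solver.Ring.AlmostCommutativeRing
  using (_-Raw-AlmostCommutative⟶_; fromCommutativeRing)
open import Data.Bool.Base using (Bool; true; false; _∧_; not; if_then_else_)
import Data.Bool.Properties as Bool
open import Data.Fin.Base using (Fin; zero; suc)
open import Data.Integer.Base as ℤ using (ℤ; +_; -[1+_]; _⊖_)
import Data.Integer.Properties as ℤ
open import Data.Maybe.Base using (Maybe; just; nothing)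
open import Data.Nat.Base as ℕ using (ℕ)
open import Data.Product.Base using (∃; _×_; _,_; proj₁; proj₂)
open import Data.Sum.Base using (_⊎_; inj₁; inj₂)
open import Relation.Binary.PropositionalEquality.Core as ≡ using (_≡_)
import Relation.Binary.Reasoning.PartialOrder as PartialOrderReasoning
import Relation.Binary.Reasoning.Setoid as SetoidReasoning
open import Relation.Nullary.Decidable.Core using (Dec; does; yes; no)
open import Relation.Nullary.Negation.Core using (¬_; contradiction)

-- Ring normalisation with integer coefficients.

module IntegerCoefficientSolver {c ℓ} (R : CommutativeRing c ℓ) where
  open CommutativeRing R
  open RingProperties ring using (-0#≈0#; -‿distribˡ-*; -‿distribʳ-*; -‿involutive)
  open AbelianGroupProperties +-abelianGroup using (⁻¹-∙-comm)
  open SemiringMult semiring using (×1-homo-*; 1+×; ×-homo-+) renaming (_×_ to _×ᴺ_)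
  open SetoidReasoning setoid

  private
    -- The optimised multiple makes `⟦ + 1 ⟧` reduce to `1#` itself, so that `con (+ 1)` meets `1#`
    -- in goals by computation alone.
    ⟦_⟧ : ℤ → Carrier
    ⟦ + n ⟧      = n ×ᴺ 1#
    ⟦ -[1+ n ] ⟧ = - (ℕ.suc n ×ᴺ 1#)

    neg-homo : ∀ n → ⟦ ℤ.- (+ n) ⟧ ≈ - (n ×ᴺ 1#)
    neg-homo ℕ.zero    = sym -0#≈0#
    neg-homo (ℕ.suc n) = refl

    -‿homo : ∀ i → ⟦ ℤ.- i ⟧ ≈ - ⟦ i ⟧
    -‿homo (+ n)      = neg-homo n
    -‿homo (-[1+ n ]) = sym (-‿involutive _)

    ⊖-homo : ∀ m n → ⟦ m ⊖ n ⟧ ≈ m ×ᴺ 1# - n ×ᴺ 1#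
    ⊖-homo m ℕ.zero = sym (trans (+-congˡ -0#≈0#) (+-identityʳ _))
    ⊖-homo ℕ.zero (ℕ.suc n) = sym (+-identityˡ _)
    ⊖-homo (ℕ.suc m) (ℕ.suc n) = begin
      ⟦ ℕ.suc m ⊖ ℕ.suc n ⟧     ≡⟨ ≡.cong ⟦_⟧ (ℤ.[1+m]⊖[1+n]≡m⊖n m n) ⟩
      ⟦ m ⊖ n ⟧                 ≈⟨ ⊖-homo m n ⟩
      a - b                     ≈⟨ +-congˡ (+-identityˡ (- b)) ⟨
      a + (0# - b)              ≈⟨ +-congˡ (+-congʳ (-‿inverseʳ 1#)) ⟨
      a + ((1# - 1#) - b)       ≈⟨ +-congˡ (+-assoc 1# (- 1#) (- b)) ⟩
      a + (1# + (- 1# - b))     ≈⟨ +-assoc a 1# _ ⟨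
      (a + 1#) + (- 1# - b)     ≈⟨ +-cong (+-comm a 1#) (⁻¹-∙-comm 1# b) ⟩
      (1# + a) - (1# + b)       ≈⟨ +-cong (1+× m 1#) (-‿cong (1+× n 1#)) ⟨
      ℕ.suc m ×ᴺ 1# - ℕ.suc n ×ᴺ 1# ∎
      where
      a = m ×ᴺ 1#
      b = n ×ᴺ 1#

    +-homo : ∀ i j → ⟦ i ℤ.+ j ⟧ ≈ ⟦ i ⟧ + ⟦ j ⟧
    +-homo (+ m)      (+ n)      = ×-homo-+ 1# m n
    +-homo (+ m)      (-[1+ n ]) = ⊖-homo m (ℕ.suc n)
    +-homo (-[1+ m ]) (+ n)      = trans (⊖-homo n (ℕ.suc m)) (+-comm _ _)
    +-homo (-[1+ m ]) (-[1+ n ]) = begin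
      - (ℕ.suc (ℕ.suc (m ℕ.+ n)) ×ᴺ 1#) ≡⟨ ≡.cong (λ k → ⟦ -[1+ k ] ⟧) (≡.sym (ℕ.+-suc m n)) ⟩
      - ((ℕ.suc m ℕ.+ ℕ.suc n) ×ᴺ 1#)   ≈⟨ -‿cong (×-homo-+ 1# (ℕ.suc m) (ℕ.suc n)) ⟩
      - (ℕ.suc m ×ᴺ 1# + ℕ.suc n ×ᴺ 1#) ≈⟨ ⁻¹-∙-comm _ _ ⟨
      - (ℕ.suc m ×ᴺ 1#) - ℕ.suc n ×ᴺ 1# ∎
      where import Data.Nat.Properties as ℕ

    *-homo : ∀ i j → ⟦ i ℤ.* j ⟧ ≈ ⟦ i ⟧ * ⟦ j ⟧
    *-homo (+ m) (+ n) = begin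
      ⟦ + m ℤ.* + n ⟧   ≡⟨ ≡.cong ⟦_⟧ (ℤ.+◃n≡+n (m ℕ.* n)) ⟩
      (m ℕ.* n) ×ᴺ 1#   ≈⟨ ×1-homo-* m n ⟩
      ⟦ + m ⟧ * ⟦ + n ⟧ ∎
    *-homo (+ m) (-[1+ n ]) = begin
      ⟦ + m ℤ.* -[1+ n ] ⟧        ≡⟨ ≡.cong ⟦_⟧ (ℤ.-◃n≡-n (m ℕ.* ℕ.suc n)) ⟩
      ⟦ ℤ.- (+ (m ℕ.* ℕ.suc n)) ⟧ ≈⟨ neg-homo (m ℕ.* ℕ.suc n) ⟩
      - ((m ℕ.* ℕ.suc n) ×ᴺ 1#)   ≈⟨ -‿cong (×1-homo-* m (ℕ.suc n)) ⟩
      - (⟦ + m ⟧ * (ℕ.suc n ×ᴺ 1#)) ≈⟨ -‿distribʳ-* _ _ ⟩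
      ⟦ + m ⟧ * ⟦ -[1+ n ] ⟧      ∎
    *-homo (-[1+ m ]) (+ n) = begin
      ⟦ -[1+ m ] ℤ.* + n ⟧        ≡⟨ ≡.cong ⟦_⟧ (ℤ.-◃n≡-n (ℕ.suc m ℕ.* n)) ⟩
      ⟦ ℤ.- (+ (ℕ.suc m ℕ.* n)) ⟧ ≈⟨ neg-homo (ℕ.suc m ℕ.* n) ⟩
      - ((ℕ.suc m ℕ.* n) ×ᴺ 1#)   ≈⟨ -‿cong (×1-homo-* (ℕ.suc m) n) ⟩
      - ((ℕ.suc m ×ᴺ 1#) * ⟦ + n ⟧) ≈⟨ -‿distribˡ-* _ _ ⟩
      ⟦ -[1+ m ] ⟧ * ⟦ + n ⟧      ∎
    *-homo (-[1+ m ]) (-[1+ n ]) = begin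
      (ℕ.suc m ℕ.* ℕ.suc n) ×ᴺ 1#  ≈⟨ ×1-homo-* (ℕ.suc m) (ℕ.suc n) ⟩
      a * b                        ≈⟨ -‿involutive (a * b) ⟨
      - (- (a * b))                ≈⟨ -‿cong (-‿distribʳ-* a b) ⟩
      - (a * - b)                  ≈⟨ -‿distribˡ-* a (- b) ⟩
      - a * - b                    ∎
      where
      a = ℕ.suc m ×ᴺ 1#
      b = ℕ.suc n ×ᴺ 1#

    ℤ-rawRing : RawRing _ _
    ℤ-rawRing = CommutativeRing.rawRing ℤ.+-*-commutativeRing

    homomorphism : ℤ-rawRing -Raw-AlmostCommutative⟶ fromCommutativeRing R
    homomorphism = record
      { ⟦_⟧    = ⟦_⟧
      ; +-homo = +-homo
      ; *-homo = *-homo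
      ; -‿homo = -‿homo
      ; 0-homo = refl
      ; 1-homo = refl
      }

    -- Detecting equal coefficients lets normal forms drop cancelled terms such as `x - x`. Distinct
    -- integers may still coincide in the ring, hence `nothing` rather than a refutation.
    coefficient≟ : ∀ i j → Maybe (⟦ i ⟧ ≈ ⟦ j ⟧)
    coefficient≟ i j with i ℤ.≟ j
    ... | yes ≡.refl = just refl
    ... | no  _      = nothing

  open RingSolver ℤ-rawRing (fromCommutativeRing R) homomorphism coefficient≟ public
    using (Polynomial; solve; _:=_; _:+_; _:*_; _:-_; con)

  -- The iterated `1 +` ending in `0` has the shape of `fromℕ n`, so the two agree by computation;
  -- `con (+ n)` denotes a sum of another shape.
  numeral : ∀ {m} → ℕ → Polynomial m
  numeral ℕ.zero    = con (+ 0)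
  numeral (ℕ.suc n) = con (+ 1) :+ numeral n

-- Yields a maximal counterexample without sorting. A counterexample among the successors is
-- displaced by `zero` only if `zero` is a counterexample above it, and transitivity then carries
-- over what was known above the old one.
extremal : ∀ {n p r} {P : Fin n → Set p} {_≺_ : Fin n → Fin n → Set r} →
           (∀ t → Dec (P t)) → (∀ s t → Dec (s ≺ t)) →
           (∀ {s} → ¬ (s ≺ s)) → (∀ {s t u} → s ≺ t → t ≺ u → s ≺ u) →
           (∀ t → P t) ⊎ ∃ λ t → ¬ P t × (∀ s → t ≺ s → P s)
extremal {ℕ.zero} P? ≺? irrefl trans = inj₁ λ ()
extremal {ℕ.suc n} {P = P} {_≺_} P? ≺? irrefl trans
  with P? zero | extremal {P = λ t → P (suc t)} (λ t → P? (suc t)) (λ s t → ≺? (suc s) (suc t)) irrefl trans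
... | yes p₀ | inj₁ p = inj₁ λ { zero → p₀ ; (suc t) → p t }
... | yes p₀ | inj₂ (t , ¬pt , above) = inj₂ (suc t , ¬pt , λ { zero _ → p₀ ; (suc s) → above s })
... | no ¬p₀ | inj₁ p = inj₂ (zero , ¬p₀ , λ { zero 0≺0 → contradiction 0≺0 irrefl ; (suc s) _ → p s })
... | no ¬p₀ | inj₂ (t , ¬pt , above) with ≺? (suc t) zero
...   | yes t≺0 = inj₂ (zero , ¬p₀ , λ { zero 0≺0 → contradiction 0≺0 irrefl ; (suc s) 0≺s → above s (trans t≺0 0≺s) })
...   | no  t⊀0 = inj₂ (suc t , ¬pt , λ { zero t≺0 → contradiction t≺0 t⊀0 ; (suc s) → above s })

-- Elementary inequalities in an ordered field.

module FieldInequalities {ℓ} (ℝ : CompleteOrderedField ℓ) where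
  open CompleteOrderedField ℝ hiding (zero)
  open RealProperties ℝ
  open PartialOrderReasoning poset
  open IntegerCoefficientSolver commutativeRing

  -- The device for polynomial inequalities: exhibit the difference as a visibly non-negative term
  -- and leave a ring identity to the solver.
  ≤-from-gap : ∀ {x y c} → 0# ≤ c → x + c ≈ y → x ≤ y
  ≤-from-gap {x} {y} {c} 0≤c x+c≈y = begin
    x     ≤⟨ x≤x+y x 0≤c ⟩
    x + c ≈⟨ x+c≈y ⟩
    y     ∎

  0≤y-x⇒x≤y : ∀ {x y} → 0# ≤ y - x → x ≤ y
  0≤y-x⇒x≤y {x} {y} p = ≤-from-gap p (solve 2 (λ x y → x :+ (y :- x) := y) ≈-refl x y)

  *-monoˡ-≤ : ∀ {z x y} → 0# ≤ z → x ≤ y → x * z ≤ y * z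
  *-monoˡ-≤ {z} {x} {y} 0≤z x≤y = begin
    x * z ≈⟨ *-comm x z ⟩
    z * x ≤⟨ *-monoʳ-≤ 0≤z x≤y ⟩
    z * y ≈⟨ *-comm z y ⟩
    y * z ∎

  -- Positivity is phrased as `¬ (z ≤ 0#)`, the form in which a case split on `z ≤? 0#` delivers it.
  *-cancelˡ-≤ : ∀ {z x y} → ¬ (z ≤ 0#) → z * x ≤ z * y → x ≤ y
  *-cancelˡ-≤ {z} {x} {y} z≰0 zx≤zy = begin
    x              ≈⟨ i*z*_≈ x ⟨
    i * (z * x)    ≤⟨ *-monoʳ-≤ (⁻¹-nonNeg (≰⇒≥ z≰0) z≉0) zx≤zy ⟩
    i * (z * y)    ≈⟨ i*z*_≈ y ⟩
    y              ∎
    where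
    i = z ⁻¹
    z≉0 : ¬ (z ≈ 0#)
    z≉0 z≈0 = z≰0 (≤-reflexive z≈0)
    i*z*_≈ : ∀ u → i * (z * u) ≈ u
    i*z* u ≈ = begin-equality
      i * (z * u)  ≈⟨ solve 3 (λ i z u → i :* (z :* u) := (z :* i) :* u) ≈-refl i z u ⟩
      z * i * u    ≈⟨ *-congʳ (⁻¹-inverseʳ z z≉0) ⟩
      1# * u       ≈⟨ *-identityˡ u ⟩
      u            ∎

  0≤fromℕ : ∀ n → 0# ≤ fromℕ n
  0≤fromℕ ℕ.zero    = ≤-refl
  0≤fromℕ (ℕ.suc n) = +-nonNeg 0≤1 (0≤fromℕ n)

  2≰0 : ¬ (fromℕ 2 ≤ 0#)
  2≰0 2≤0 = 1≉0 (antisym (≤-trans (x≤x+y 1# (0≤fromℕ 1)) 2≤0) 0≤1)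

  2½≈1 : ½ + ½ ≈ 1#
  2½≈1 = begin-equality
    ½ + ½         ≈⟨ solve 1 (λ h → h :+ h := (con (+ 1) :+ (con (+ 1) :+ con (+ 0))) :* h) ≈-refl ½ ⟩
    fromℕ 2 * ½   ≈⟨ ⁻¹-inverseʳ (fromℕ 2) (λ 2≈0 → 2≰0 (≤-reflexive 2≈0)) ⟩
    1#            ∎

  0≤½ : 0# ≤ ½
  0≤½ = ⁻¹-nonNeg (0≤fromℕ 2) (λ 2≈0 → 2≰0 (≤-reflexive 2≈0))

  -- Serves to clear `½`, which is an atom for the solver: after doubling, `2½≈1` removes it.
  double-cancel-≤ : ∀ {x y} → x + x ≤ y + y → x ≤ y
  double-cancel-≤ {x} {y} 2x≤2y = *-cancelˡ-≤ 2≰0 (begin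
    fromℕ 2 * x ≈⟨ two x ⟩
    x + x       ≤⟨ 2x≤2y ⟩
    y + y       ≈⟨ two y ⟨
    fromℕ 2 * y ∎)
    where
    two : ∀ u → fromℕ 2 * u ≈ u + u
    two = solve 1 (λ u → (con (+ 1) :+ (con (+ 1) :+ con (+ 0))) :* u := u :+ u) ≈-refl

  -- Finite sums and products, and independent trials.

  open SemiringSum semiring public using (*-distribˡ-sum; *-distribʳ-sum; ∑-distrib-+; ∑-comm)
  open CommutativeMonoidSum *-commutativeMonoid public using () renaming (∑-distrib-+ to product-distrib-*)

  sum-mono-≤ : ∀ {n} {f g : Fin n → Carrier} → (∀ i → f i ≤ g i) → sum f ≤ sum g
  sum-mono-≤ {ℕ.zero}  f≤g = ≤-refl
  sum-mono-≤ {ℕ.suc n} f≤g = +-mono-≤ (f≤g zero) (sum-mono-≤ λ i → f≤g (suc i))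

  sum-nonNeg : ∀ {n} {f : Fin n → Carrier} → (∀ i → 0# ≤ f i) → 0# ≤ sum f
  sum-nonNeg {ℕ.zero}  0≤f = ≤-refl
  sum-nonNeg {ℕ.suc n} 0≤f = +-nonNeg (0≤f zero) (sum-nonNeg λ i → 0≤f (suc i))

  term≤sum : ∀ {n} {f : Fin n → Carrier} → (∀ i → 0# ≤ f i) → ∀ i → f i ≤ sum f
  term≤sum {f = f} 0≤f zero = x≤x+y (f zero) (sum-nonNeg λ i → 0≤f (suc i))
  term≤sum {f = f} 0≤f (suc i) = begin
    f (suc i)                     ≤⟨ term≤sum (λ j → 0≤f (suc j)) i ⟩
    sum (λ j → f (suc j))         ≤⟨ ≤-from-gap (0≤f zero) (+-comm _ _) ⟩
    f zero + sum (λ j → f (suc j)) ∎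

  sum-zero : ∀ {n} {f : Fin n → Carrier} → (∀ i → f i ≈ 0#) → sum f ≈ 0#
  sum-zero {ℕ.zero}  f≈0 = ≈-refl
  sum-zero {ℕ.suc n} f≈0 = ≈-trans (+-cong (f≈0 zero) (sum-zero λ i → f≈0 (suc i))) (+-identityˡ 0#)

  sum-linear : ∀ {n} a b (f g : Fin n → Carrier) → a * sum f + b * sum g ≈ sum λ i → a * f i + b * g i
  sum-linear a b f g = begin-equality
    a * sum f + b * sum g                           ≈⟨ +-cong (*-distribˡ-sum a f) (*-distribˡ-sum b g) ⟩
    sum (λ i → a * f i) + sum (λ i → b * g i)       ≈⟨ ∑-distrib-+ (λ i → a * f i) (λ i → b * g i) ⟨
    sum (λ i → a * f i + b * g i)                   ∎

  product-nonNeg : ∀ {n} {f : Fin n → Carrier} → (∀ i → 0# ≤ f i) → 0# ≤ product f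
  product-nonNeg {ℕ.zero}  0≤f = 0≤1
  product-nonNeg {ℕ.suc n} 0≤f = *-nonNeg (0≤f zero) (product-nonNeg λ i → 0≤f (suc i))

  product-mono-≤ : ∀ {n} {f g : Fin n → Carrier} → (∀ i → 0# ≤ f i) → (∀ i → f i ≤ g i) → product f ≤ product g
  product-mono-≤ {ℕ.zero}  0≤f f≤g = ≤-refl
  product-mono-≤ {ℕ.suc n} 0≤f f≤g =
    *-mono-≤ (0≤f zero) (product-nonNeg λ i → ≤-trans (0≤f (suc i)) (f≤g (suc i))) (f≤g zero)
      (product-mono-≤ (λ i → 0≤f (suc i)) (λ i → f≤g (suc i)))

  product-ones : ∀ {n} {f : Fin n → Carrier} → (∀ i → f i ≈ 1#) → product f ≈ 1#
  product-ones {ℕ.zero}  f≈1 = ≈-refl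
  product-ones {ℕ.suc n} f≈1 = ≈-trans (*-cong (f≈1 zero) (product-ones λ i → f≈1 (suc i))) (*-identityˡ 1#)

  1-x≤1 : ∀ {x} → 0# ≤ x → 1# - x ≤ 1#
  1-x≤1 {x} 0≤x = ≤-from-gap 0≤x (x-y+y≈x 1# x)

  if-nonNeg : ∀ b {v} → 0# ≤ v → 0# ≤ (if b then v else 0#)
  if-nonNeg true  0≤v = 0≤v
  if-nonNeg false 0≤v = ≤-refl

  if-mono-≤ : ∀ b {u v} → u ≤ v → (if b then u else 0#) ≤ (if b then v else 0#)
  if-mono-≤ true  u≤v = u≤v
  if-mono-≤ false u≤v = ≤-refl

  -- The last summand is the probability that t is the heaviest success among
  -- independent trials with success probabilities y, up to ties, which can
  -- only be counted twice.
  failure+heaviest-success : ∀ {n} (w y : Fin n → Carrier) → (∀ i → 0# ≤ y i) → (∀ i → y i ≤ 1#) →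
    1# ≤ product (λ s → 1# - y s) +
         sum (λ t → y t * product λ s → if does (w t <? w s) then 1# - y s else 1#)
  failure+heaviest-success {ℕ.zero} w y 0≤y y≤1 = ≤-reflexive (≈-sym (+-identityʳ 1#))
  failure+heaviest-success {ℕ.suc n} w y 0≤y y≤1 = begin
    1#
      -- Condition on whether trial `zero` fails or succeeds.
      ≈⟨ solve 1 (λ y₀ → con (+ 1) := (con (+ 1) :- y₀) :* con (+ 1) :+ y₀ :* con (+ 1)) ≈-refl y₀ ⟩
    (1# - y₀) * 1# + y₀ * 1#
      ≤⟨ +-mono-≤ (*-monoʳ-≤ (x≤y⇒0≤y-x (y≤1 zero)) tail-bound) (*-monoʳ-≤ (0≤y zero) light-bound) ⟩
    (1# - y₀) * (P + sum λ t → y′ t * G t) + y₀ * (G₀ + sum λ t → if lighter t then 0# else y′ t * G t)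
      ≈⟨ solve 5 (λ y₀ P S G₀ S′ → (con (+ 1) :- y₀) :* (P :+ S) :+ y₀ :* (G₀ :+ S′)
           := (con (+ 1) :- y₀) :* P :+ (y₀ :* (con (+ 1) :* G₀) :+ ((con (+ 1) :- y₀) :* S :+ y₀ :* S′)))
           ≈-refl y₀ P _ G₀ _ ⟩
    (1# - y₀) * P + (y₀ * (1# * G₀) + ((1# - y₀) * (sum λ t → y′ t * G t) + y₀ * (sum λ t → if lighter t then 0# else y′ t * G t)))
      ≈⟨ +-congˡ (+-cong (*-congˡ (*-congʳ not-above-itself)) (≈-trans (sum-linear (1# - y₀) y₀ (λ t → y′ t * G t) (λ t → if lighter t then 0# else y′ t * G t)) (sum-cong-≋ split))) ⟩
    (1# - y₀) * P + (y₀ * ((if does (w zero <? w zero) then 1# - y₀ else 1#) * G₀)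
      + sum λ t → y′ t * ((if lighter t then 1# - y₀ else 1#) * G t))
      ∎
    where
    y₀ = y zero
    w′ y′ : Fin n → Carrier
    w′ t = w (suc t)
    y′ t = y (suc t)
    lighter : Fin n → Bool
    lighter t = does (w′ t <? w zero)
    P G₀ : Carrier
    P = product λ s → 1# - y′ s
    G₀ = product λ s → if does (w zero <? w′ s) then 1# - y′ s else 1#
    G : Fin n → Carrier
    G t = product λ s → if does (w′ t <? w′ s) then 1# - y′ s else 1#

    tail-bound = failure+heaviest-success w′ y′ (λ i → 0≤y (suc i)) (λ i → y≤1 (suc i))

    not-above-itself : 1# ≈ (if does (w zero <? w zero) then 1# - y₀ else 1#)
    not-above-itself with w zero <? w zero
    ... | yes w<w = contradiction w<w (<-irrefl ≈-refl)
    ... | no  _   = ≈-refl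

    split : ∀ t → (1# - y₀) * (y′ t * G t) + y₀ * (if lighter t then 0# else y′ t * G t)
                ≈ y′ t * ((if lighter t then 1# - y₀ else 1#) * G t)
    split t with lighter t
    ... | true  = solve 3 (λ a y g → (con (+ 1) :- a) :* (y :* g) :+ a :* con (+ 0) := y :* ((con (+ 1) :- a) :* g)) ≈-refl y₀ (y′ t) (G t)
    ... | false = solve 3 (λ a y g → (con (+ 1) :- a) :* (y :* g) :+ a :* (y :* g) := y :* (con (+ 1) :* g)) ≈-refl y₀ (y′ t) (G t)

    -- Once trial `zero` succeeds, a strictly lighter trial cannot be the heaviest success, so the
    -- induction hypothesis is applied with those probabilities set to zero. Trials tied with `zero`
    -- keep theirs; this is where ties are counted twice.
    z : Fin n → Carrier
    z t = if lighter t then 0# else y′ t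

    0≤z : ∀ t → 0# ≤ z t
    0≤z t with lighter t
    ... | true  = ≤-refl
    ... | false = 0≤y (suc t)
    z≤1 : ∀ t → z t ≤ 1#
    z≤1 t with lighter t
    ... | true  = 0≤1
    ... | false = y≤1 (suc t)

    light-factor : ∀ s → 1# - z s ≤ (if does (w zero <? w′ s) then 1# - y′ s else 1#)
    light-factor s with w′ s <? w zero | w zero <? w′ s
    ... | yes s<0 | yes 0<s = contradiction (<-trans s<0 0<s) (<-irrefl ≈-refl)
    ... | yes _   | no  _   = 1-x≤1 ≤-refl
    ... | no  _   | yes _   = ≤-refl
    ... | no  _   | no  _   = 1-x≤1 (0≤y (suc s))

    heavy-factor : ∀ {t} → ¬ (w′ t < w zero) → ∀ s →
      (if does (w′ t <? w′ s) then 1# - z s else 1#) ≈ (if does (w′ t <? w′ s) then 1# - y′ s else 1#)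
    heavy-factor {t} t≮0 s with w′ t <? w′ s | w′ s <? w zero
    ... | yes t<s | yes s<0 = contradiction (<-trans t<s s<0) t≮0
    ... | yes _   | no  _   = ≈-refl
    ... | no  _   | _       = ≈-refl

    light-term : ∀ t → z t * (product λ s → if does (w′ t <? w′ s) then 1# - z s else 1#)
                     ≤ (if lighter t then 0# else y′ t * G t)
    light-term t with w′ t <? w zero
    ... | yes _   = ≤-reflexive (zeroˡ _)
    ... | no  t≮0 = ≤-reflexive (*-congˡ (product-cong-≋ (heavy-factor t≮0)))

    light-bound : 1# ≤ G₀ + sum λ t → if lighter t then 0# else y′ t * G t
    light-bound = ≤-trans (failure+heaviest-success w′ z 0≤z z≤1)
      (+-mono-≤ (product-mono-≤ (λ s → x≤y⇒0≤y-x (z≤1 s)) light-factor) (sum-mono-≤ light-term))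

  -- Numerical estimates for small `ε`.

  ε⁴≤10⁻⁴⇒10ε≤1 : ∀ {ε} → 0# ≤ ε → ε ^ 4 ≤ 10⁻⁴ → fromℕ 10 * ε ≤ 1#
  -- The fourth power of `u = ten * ε` is at most `1#`; two square roots give the claim.
  ε⁴≤10⁻⁴⇒10ε≤1 {ε} 0≤ε ε⁴≤ = sqrt≤1 0≤u (sqrt≤1 (*-nonNeg 0≤u 0≤u) (begin
    (u * u) * (u * u)
      ≈⟨ solve 2 (λ t e → ((t :* e) :* (t :* e)) :* ((t :* e) :* (t :* e))
           := (t :* (t :* (t :* (t :* con (+ 1))))) :* (e :* (e :* (e :* (e :* con (+ 1)))))) ≈-refl ten ε ⟩
    ten ^ 4 * ε ^ 4
      ≤⟨ *-monoʳ-≤ (≤-trans 0≤1 1≤10⁴) ε⁴≤ ⟩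
    ten ^ 4 * 10⁻⁴
      ≈⟨ ⁻¹-inverseʳ (ten ^ 4) (λ N≈0 → 1≉0 (antisym (≤-trans 1≤10⁴ (≤-reflexive N≈0)) 0≤1)) ⟩
    1# ∎))
    where
    ten u : Carrier
    ten = fromℕ 10
    u = ten * ε
    0≤u : 0# ≤ u
    0≤u = *-nonNeg (0≤fromℕ 10) 0≤ε
    1≤ten : 1# ≤ ten
    1≤ten = x≤x+y 1# (0≤fromℕ 9)
    1≤* : ∀ {x} → 1# ≤ x → 1# ≤ ten * x
    1≤* {x} 1≤x = ≤-respˡ-≈ (*-identityˡ 1#) (*-mono-≤ 0≤1 (≤-trans 0≤1 1≤x) 1≤ten 1≤x)
    1≤10⁴ : 1# ≤ ten ^ 4
    1≤10⁴ = 1≤* (1≤* (1≤* (1≤* ≤-refl)))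
    sqrt≤1 : ∀ {x} → 0# ≤ x → x * x ≤ 1# → x ≤ 1#
    sqrt≤1 0≤x x²≤1 = x²≤y²⇒x≤y 0≤x 0≤1 (≤-respʳ-≈ (≈-sym (*-identityˡ 1#)) x²≤1)

  module SmallEpsilon {ε} (0≤ε : 0# ≤ ε) (10ε≤1 : fromℕ 10 * ε ≤ 1#) where
    ε≤1 : ε ≤ 1#
    ε≤1 = ≤-trans (≤-from-gap (*-nonNeg (0≤fromℕ 9) 0≤ε) (solve 1 (λ e → e :+ numeral 9 :* e := numeral 10 :* e) ≈-refl ε)) 10ε≤1

    0≤1-ε : 0# ≤ 1# - ε
    0≤1-ε = x≤y⇒0≤y-x ε≤1

    0≤ε² : 0# ≤ ε * ε
    0≤ε² = *-nonNeg 0≤ε 0≤ε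

    ε²≤ε : ε * ε ≤ ε
    ε²≤ε = ≤-trans (*-monoʳ-≤ 0≤ε ε≤1) (≤-reflexive (*-identityʳ ε))

    0≤ε³ : 0# ≤ ε * ε * ε
    0≤ε³ = *-nonNeg 0≤ε² 0≤ε

    -- After doubling, the gap is `(1 - 10ε) + 2ε(1 - ε²)`. This is the slack that turns a bound
    -- `4ε³` on `(½ - ε³) q²` into `q ≤ ε`.
    4ε≤½-ε³ : fromℕ 4 * ε ≤ ½ - ε * ε * ε
    4ε≤½-ε³ = double-cancel-≤ (≤-from-gap
      (+-nonNeg (x≤y⇒0≤y-x 10ε≤1) (*-nonNeg (+-nonNeg 0≤ε 0≤ε) (*-nonNeg 0≤1-ε (+-nonNeg 0≤1 0≤ε))))
      (begin-equality
        (fromℕ 4 * ε + fromℕ 4 * ε) + ((1# - fromℕ 10 * ε) + (ε + ε) * ((1# - ε) * (1# + ε)))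
          ≈⟨ solve 1 (λ e → (numeral 4 :* e :+ numeral 4 :* e)
               :+ ((con (+ 1) :- numeral 10 :* e) :+ (e :+ e) :* ((con (+ 1) :- e) :* (con (+ 1) :+ e)))
               := con (+ 1) :- (e :* e :* e :+ e :* e :* e)) ≈-refl ε ⟩
        1# - (ε * ε * ε + ε * ε * ε)       ≈⟨ +-congʳ 2½≈1 ⟨
        (½ + ½) - (ε * ε * ε + ε * ε * ε)
          ≈⟨ solve 2 (λ h d → (h :+ h) :- (d :+ d) := (h :- d) :+ (h :- d)) ≈-refl ½ (ε * ε * ε) ⟩
        (½ - ε * ε * ε) + (½ - ε * ε * ε)  ∎))

    4ε-gap : 0# ≤ (½ - ε * ε * ε) - fromℕ 4 * ε
    4ε-gap = x≤y⇒0≤y-x 4ε≤½-ε³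

    -- The gap is `ε(½ - ε² - ε³)`, written as `ε` times the sum of `(½ - ε³) - 4ε` and `ε(4 - ε)`.
    [½+ε³][1+ε]≤½+ε : (½ + ε * ε * ε) * (1# + ε) ≤ ½ + ε
    [½+ε³][1+ε]≤½+ε = ≤-from-gap (*-nonNeg 0≤ε (+-nonNeg 4ε-gap (*-nonNeg 0≤ε (+-nonNeg 0≤1-ε (+-nonNeg 0≤1 (+-nonNeg 0≤1 0≤1)))))) (begin-equality
      (½ + ε * ε * ε) * (1# + ε) + ε * (((½ - ε * ε * ε) - fromℕ 4 * ε) + ε * ((1# - ε) + (1# + (1# + 1#))))
        ≈⟨ solve 2 (λ h e → (h :+ e :* e :* e) :* (con (+ 1) :+ e)
             :+ e :* (((h :- e :* e :* e) :- numeral 4 :* e) :+ e :* ((con (+ 1) :- e) :+ (con (+ 1) :+ (con (+ 1) :+ con (+ 1)))))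
             := h :+ (h :+ h) :* e) ≈-refl ½ ε ⟩
      ½ + (½ + ½) * ε ≈⟨ +-congˡ (≈-trans (*-congʳ 2½≈1) (*-identityˡ ε)) ⟩
      ½ + ε ∎)

    ½-ε³≰0 : ¬ (½ - ε * ε * ε ≤ 0#)
    ½-ε³≰0 k≤0 = 1≉0 (antisym 1≤0 0≤1)
      where
      k = ½ - ε * ε * ε
      ½≤2k : ½ ≤ k + k
      ½≤2k = ≤-from-gap (+-nonNeg 4ε-gap (*-nonNeg 0≤ε (+-nonNeg (+-nonNeg 0≤1-ε (*-nonNeg 0≤ε 0≤1-ε)) (+-nonNeg 0≤1 (+-nonNeg 0≤1 0≤1)))))
        (solve 2 (λ h e → h :+ (((h :- e :* e :* e) :- numeral 4 :* e)
             :+ e :* (((con (+ 1) :- e) :+ e :* (con (+ 1) :- e)) :+ (con (+ 1) :+ (con (+ 1) :+ con (+ 1)))))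
           := (h :- e :* e :* e) :+ (h :- e :* e :* e)) ≈-refl ½ ε)
      ½≤0 : ½ ≤ 0#
      ½≤0 = ≤-trans ½≤2k (≤-trans (+-mono-≤ k≤0 k≤0) (≤-reflexive (+-identityˡ 0#)))
      1≤0 : 1# ≤ 0#
      1≤0 = ≤-trans (≤-reflexive (≈-sym 2½≈1)) (≤-trans (+-mono-≤ ½≤0 ½≤0) (≤-reflexive (+-identityˡ 0#)))

    -- Rules out rows of total mass at most `ε * ε`. Otherwise `ε² ≤ ε` and the preceding estimate
    -- give `½ ≤ ε`, while `4ε ≤ ½`; hence `ε ≤ 0`, and then `½ - ε³ ≤ 0`.
    1≰[½+ε³][1+ε²] : ¬ (1# ≤ (½ + ε * ε * ε) * (1# + ε * ε))
    1≰[½+ε³][1+ε²] 1≤ = ½-ε³≰0 (≤-trans (≤-from-gap 0≤ε³ (x-y+y≈x ½ (ε * ε * ε))) (≤-trans ½≤ε ε≤0))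
      where
      ½≤ε : ½ ≤ ε
      ½≤ε = +-cancelˡ-≤ ½ (begin
        ½ + ½                              ≈⟨ 2½≈1 ⟩
        1#                                 ≤⟨ 1≤ ⟩
        (½ + ε * ε * ε) * (1# + ε * ε)     ≤⟨ *-monoʳ-≤ (+-nonNeg 0≤½ 0≤ε³) (+-monoʳ-≤ 1# ε²≤ε) ⟩
        (½ + ε * ε * ε) * (1# + ε)         ≤⟨ [½+ε³][1+ε]≤½+ε ⟩
        ½ + ε                              ∎)
      ε≤0 : ε ≤ 0#
      ε≤0 = +-cancelˡ-≤ ε (begin
        ε + ε           ≤⟨ ≤-from-gap (+-nonNeg 0≤ε 0≤ε) (solve 1 (λ e → (e :+ e) :+ (e :+ e) := numeral 4 :* e) ≈-refl ε) ⟩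
        fromℕ 4 * ε     ≤⟨ 4ε≤½-ε³ ⟩
        ½ - ε * ε * ε   ≤⟨ ≤-from-gap 0≤ε³ (x-y+y≈x ½ (ε * ε * ε)) ⟩
        ½               ≤⟨ ½≤ε ⟩
        ε               ≈⟨ +-identityʳ ε ⟨
        ε + 0#          ∎)

-- Threshold sums of a single row.

module Rows {ℓ} (ℝ : CompleteOrderedField ℓ) where
  open CompleteOrderedField ℝ hiding (zero)
  open RealProperties ℝ
  open FieldInequalities ℝ
  open PartialOrderReasoning poset
  open IntegerCoefficientSolver commutativeRing

  module Row {n} (w x : Fin n → Carrier) (0≤w : ∀ t → 0# ≤ w t) (0≤x : ∀ t → 0# ≤ x t)
             (∑x≤1 : sum x ≤ 1#) where
    x≤1 : ∀ t → x t ≤ 1#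
    x≤1 t = ≤-trans (term≤sum 0≤x t) ∑x≤1

    0≤1-x : ∀ t → 0# ≤ 1# - x t
    0≤1-x t = x≤y⇒0≤y-x (x≤1 t)

    0≤wx : ∀ t → 0# ≤ w t * x t
    0≤wx t = *-nonNeg (0≤w t) (0≤x t)

    Event : Set
    Event = Fin n → Bool

    all none : Event
    all  _ = true
    none _ = false

    _∖_ : Event → Event → Event
    (A ∖ B) t = A t ∧ not (B t)

    _⊆_ : Event → Event → Set
    B ⊆ A = ∀ t → B t ≡ true → A t ≡ true

    above : Fin n → Event
    above t s = does (w t <? w s)

    -- The non-strict order keeps elements of equal weight together, as the sets `τ ≤ w t` do.
    Upper : Event → Set ℓ
    Upper A = ∀ {s t} → w s ≤ w t → A s ≡ true → A t ≡ true

    upper-< : ∀ {A s t} → Upper A → w s < w t → A s ≡ true → A t ≡ true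
    upper-< upper (s≤t , _) = upper s≤t

    <-≤-trans : ∀ {a b c} → a < b → b ≤ c → a < c
    <-≤-trans (a≤b , a≉b) b≤c =
      ≤-trans a≤b b≤c , λ a≈c → a≉b (antisym a≤b (≤-trans b≤c (≤-reflexive (≈-sym a≈c))))

    exceeding : Carrier → Event
    exceeding τ t = does (τ <? w t)

    exceeding-upper : ∀ τ → Upper (exceeding τ)
    exceeding-upper τ {s} {t} s≤t s∈ with τ <? w s | τ <? w t
    ... | yes _   | yes _   = ≡.refl
    ... | yes τ<s | no  τ≮t = contradiction (<-≤-trans τ<s s≤t) τ≮t

    above-upper : ∀ t → Upper (above t)
    above-upper t = exceeding-upper (w t)

    -- The probability that no element of `A` strictly lighter than `u` succeeds, in independent
    -- trials with success probabilities `x`.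
    vacancy : Event → Fin n → Carrier
    vacancy A u = product λ s → if A s ∧ does (w s <? w u) then 1# - x s else 1#

    -- `reward A` is the expected total weight of the lightest successes in `A`; for `A` given by
    -- `τ ≤ w t` it is the threshold sum at `τ`.
    reward mass value : Event → Carrier
    reward A = sum λ u → if A u then vacancy A u * x u * w u else 0#
    mass   A = sum λ t → if A t then x t else 0#
    value  A = sum λ t → if A t then w t * x t else 0#

    0≤factor : ∀ s b → 0# ≤ (if b then 1# - x s else 1#)
    0≤factor s true  = 0≤1-x s
    0≤factor s false = 0≤1

    0≤vacancy : ∀ A u → 0# ≤ vacancy A u
    0≤vacancy A u = product-nonNeg λ s → 0≤factor s (A s ∧ does (w s <? w u))

    vacancy≤1 : ∀ A u → vacancy A u ≤ 1#
    vacancy≤1 A u = ≤-trans (product-mono-≤ (λ s → 0≤factor s (A s ∧ does (w s <? w u))) (λ s → factor≤1 s (A s ∧ does (w s <? w u))))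
      (≤-reflexive (product-ones {n} λ _ → ≈-refl))
      where
      factor≤1 : ∀ s b → (if b then 1# - x s else 1#) ≤ 1#
      factor≤1 s true  = 1-x≤1 (0≤x s)
      factor≤1 s false = ≤-refl

    0≤gain : ∀ A u → 0# ≤ vacancy A u * x u * w u
    0≤gain A u = *-nonNeg (*-nonNeg (0≤vacancy A u) (0≤x u)) (0≤w u)

    0≤reward : ∀ A → 0# ≤ reward A
    0≤reward A = sum-nonNeg λ u → if-nonNeg (A u) (0≤gain A u)

    0≤mass : ∀ A → 0# ≤ mass A
    0≤mass A = sum-nonNeg λ t → if-nonNeg (A t) (0≤x t)

    0≤value : ∀ A → 0# ≤ value A
    0≤value A = sum-nonNeg λ t → if-nonNeg (A t) (0≤wx t)

    reward≤value : ∀ A → reward A ≤ value A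
    reward≤value A = sum-mono-≤ λ u → if-mono-≤ (A u) (begin
      vacancy A u * x u * w u ≈⟨ solve 3 (λ v x w → v :* x :* w := v :* (w :* x)) ≈-refl (vacancy A u) (x u) (w u) ⟩
      vacancy A u * (w u * x u) ≤⟨ *-monoˡ-≤ (0≤wx u) (vacancy≤1 A u) ⟩
      1# * (w u * x u)          ≈⟨ *-identityˡ _ ⟩
      w u * x u                 ∎)

    reward-cong : ∀ {A B} → (∀ t → A t ≡ B t) → reward A ≈ reward B
    reward-cong {A} {B} A≡B = sum-cong-≋ λ u → term u
      where
      vac : ∀ u → vacancy A u ≈ vacancy B u
      vac u = product-cong-≋ λ s → ≡.subst (λ b → (if A s ∧ _ then 1# - x s else 1#) ≈ (if b ∧ _ then 1# - x s else 1#)) (A≡B s) ≈-refl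
      term : ∀ u → (if A u then vacancy A u * x u * w u else 0#) ≈ (if B u then vacancy B u * x u * w u else 0#)
      term u rewrite A≡B u with B u
      ... | true  = *-congʳ (*-congʳ (vac u))
      ... | false = ≈-refl

    -- When u is not blocked by B, either it is not blocked by A, or the heaviest
    -- success in A ∖ B below u is some t, and then u is not blocked by `above t`.
    vacancy-expand : ∀ {A B} → Upper A → Upper B → B ⊆ A → ∀ u →
      vacancy B u ≤ vacancy A u + sum λ t →
        if (A ∖ B) t ∧ above t u then x t * vacancy (above t) u else 0#
    vacancy-expand {A} {B} A↑ B↑ B⊆A u = begin
      vacancy B u
        ≈⟨ *-identityʳ _ ⟨
      vacancy B u * 1#
        ≤⟨ *-monoʳ-≤ (0≤vacancy B u) (failure+heaviest-success w y 0≤y y≤1) ⟩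
      vacancy B u * (product (λ s → 1# - y s) + sum λ t → y t * heavier t)
        ≈⟨ distribˡ _ _ _ ⟩
      vacancy B u * product (λ s → 1# - y s) + vacancy B u * (sum λ t → y t * heavier t)
        ≈⟨ +-cong (≈-trans (≈-sym (product-distrib-* (blockB) (λ s → 1# - y s))) (product-cong-≋ no-success))
                  (*-distribˡ-sum (vacancy B u) (λ t → y t * heavier t)) ⟩
      vacancy A u + (sum λ t → vacancy B u * (y t * heavier t))
        ≈⟨ +-congˡ (sum-cong-≋ heaviest) ⟩
      vacancy A u + (sum λ t → if (A ∖ B) t ∧ above t u then x t * vacancy (above t) u else 0#)
        ∎
      where
      -- Only elements of `A ∖ B` lighter than `u` take part in the trials.
      y : Fin n → Carrier
      y s = if (A ∖ B) s ∧ above s u then x s else 0#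
      heavier blockB : Fin n → Carrier
      heavier t = product λ s → if does (w t <? w s) then 1# - y s else 1#
      blockB s = if B s ∧ does (w s <? w u) then 1# - x s else 1#

      0≤y : ∀ s → 0# ≤ y s
      0≤y s = if-nonNeg ((A ∖ B) s ∧ above s u) (0≤x s)
      y≤1 : ∀ s → y s ≤ 1#
      y≤1 s with (A ∖ B) s ∧ above s u
      ... | true  = x≤1 s
      ... | false = 0≤1

      1-0≈1 : 1# - 0# ≈ 1#
      1-0≈1 = solve 0 (con (+ 1) :- con (+ 0) := con (+ 1)) ≈-refl

      no-success : ∀ s → blockB s * (1# - y s) ≈ (if A s ∧ does (w s <? w u) then 1# - x s else 1#)
      no-success s with A s in s∈A | B s in s∈B | w s <? w u
      ... | true  | true  | yes _ = ≈-trans (*-congˡ 1-0≈1) (*-identityʳ _)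
      ... | true  | true  | no  _ = ≈-trans (*-congˡ 1-0≈1) (*-identityʳ _)
      ... | true  | false | yes _ = *-identityˡ _
      ... | true  | false | no  _ = ≈-trans (*-congˡ 1-0≈1) (*-identityʳ _)
      ... | false | true  | _ = contradiction (≡.trans (≡.sym s∈A) (B⊆A s s∈B)) (λ ())
      ... | false | false | _ = ≈-trans (*-congˡ 1-0≈1) (*-identityʳ _)

      module _ {t} (t∈A : A t ≡ true) (t∉B : B t ≡ false) where
        -- An `s` heavier than `t` lies in `A`, since `A` is upper, and enters through exactly one
        -- of `B` and `A ∖ B`. An `s` not heavier than `t` lies outside `B`, since `B` is upper and
        -- misses `t`.
        factor : ∀ s → blockB s * (if does (w t <? w s) then 1# - y s else 1#)
                     ≈ (if above t s ∧ does (w s <? w u) then 1# - x s else 1#)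
        factor s with w t <? w s | A s in s∈A | B s in s∈B | w s <? w u
        ... | yes _   | true  | true  | yes _ = ≈-trans (*-congˡ 1-0≈1) (*-identityʳ _)
        ... | yes _   | true  | true  | no  _ = ≈-trans (*-congˡ 1-0≈1) (*-identityʳ _)
        ... | yes _   | true  | false | yes _ = *-identityˡ _
        ... | yes _   | true  | false | no  _ = ≈-trans (*-congˡ 1-0≈1) (*-identityʳ _)
        ... | yes t<s | false | _     | _     = contradiction (≡.trans (≡.sym s∈A) (upper-< {A} A↑ t<s t∈A)) (λ ())
        ... | no  t≮s | _     | true  | _     = contradiction (≡.trans (≡.sym t∉B) (B↑ (≮⇒≥ t≮s) s∈B)) (λ ())
        ... | no  _   | _     | false | _     = *-identityʳ _

        heavier-vacancy : vacancy B u * heavier t ≈ vacancy (above t) u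
        heavier-vacancy = ≈-trans (≈-sym (product-distrib-* blockB _)) (product-cong-≋ factor)

      heaviest : ∀ t → vacancy B u * (y t * heavier t)
                     ≈ (if (A ∖ B) t ∧ above t u then x t * vacancy (above t) u else 0#)
      heaviest t with A t in t∈A | B t in t∉B | above t u
      ... | true  | false | true = begin-equality
        vacancy B u * (x t * heavier t)   ≈⟨ solve 3 (λ v x h → v :* (x :* h) := x :* (v :* h)) ≈-refl (vacancy B u) (x t) (heavier t) ⟩
        x t * (vacancy B u * heavier t)   ≈⟨ *-congˡ (heavier-vacancy t∈A t∉B) ⟩
        x t * vacancy (above t) u         ∎
      ... | true  | false | false = ≈-trans (*-congˡ (zeroˡ _)) (zeroʳ _)
      ... | true  | true  | _     = ≈-trans (*-congˡ (zeroˡ _)) (zeroʳ _)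
      ... | false | _     | _     = ≈-trans (*-congˡ (zeroˡ _)) (zeroʳ _)

    -- For `u` in `A`, multiply `vacancy-expand` by `x u * w u`. If `u` is outside `B`, no element
    -- of the upper set `B` is lighter than `u`, so `vacancy B u` is `1#` and the left side is the
    -- full value of `u`. Summing over `u` and exchanging sums collects the terms of each `t` into
    -- `x t * reward (above t)`.
    reward-exchange : ∀ {A B} → Upper A → Upper B → B ⊆ A →
      reward B + value (A ∖ B) ≤ reward A + sum λ t → if (A ∖ B) t then x t * reward (above t) else 0#
    reward-exchange {A} {B} A↑ B↑ B⊆A = begin
      reward B + value (A ∖ B)
        ≈⟨ ∑-distrib-+ (λ u → if B u then vacancy B u * x u * w u else 0#) (λ u → if (A ∖ B) u then w u * x u else 0#) ⟨
      sum (λ u → (if B u then vacancy B u * x u * w u else 0#) + (if (A ∖ B) u then w u * x u else 0#))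
        ≤⟨ sum-mono-≤ pointwise ⟩
      sum (λ u → (if A u then vacancy A u * x u * w u else 0#) + sum λ t → contribution t u)
        ≈⟨ ∑-distrib-+ (λ u → if A u then vacancy A u * x u * w u else 0#) (λ u → sum λ t → contribution t u) ⟩
      reward A + sum (λ u → sum λ t → contribution t u)
        ≈⟨ +-congˡ (∑-comm (λ u t → contribution t u)) ⟩
      reward A + sum (λ t → sum (contribution t))
        ≈⟨ +-congˡ (sum-cong-≋ collect) ⟩
      reward A + sum (λ t → if (A ∖ B) t then x t * reward (above t) else 0#)
        ∎
      where
      contribution : Fin n → Fin n → Carrier
      contribution t u = if (A ∖ B) t then x t * (if above t u then vacancy (above t) u * x u * w u else 0#) else 0#

      0≤contribution : ∀ t u → 0# ≤ contribution t u
      0≤contribution t u = if-nonNeg ((A ∖ B) t) (*-nonNeg (0≤x t) (if-nonNeg (above t u) (0≤gain (above t) u)))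

      collect : ∀ t → sum (contribution t) ≈ (if (A ∖ B) t then x t * reward (above t) else 0#)
      collect t with (A ∖ B) t
      ... | true  = ≈-sym (*-distribˡ-sum (x t) (λ u → if above t u then vacancy (above t) u * x u * w u else 0#))
      ... | false = sum-zero {n} λ _ → ≈-refl

      collect-u : ∀ u → (sum λ t → if (A ∖ B) t ∧ above t u then x t * vacancy (above t) u else 0#) * (x u * w u)
                      ≈ sum λ t → contribution t u
      collect-u u = ≈-trans (*-distribʳ-sum (x u * w u) λ t → if (A ∖ B) t ∧ above t u then x t * vacancy (above t) u else 0#)
                            (sum-cong-≋ term)
        where
        term : ∀ t → (if (A ∖ B) t ∧ above t u then x t * vacancy (above t) u else 0#) * (x u * w u) ≈ contribution t u
        term t with (A ∖ B) t | above t u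
        ... | true  | true  = solve 4 (λ x v y w → x :* v :* (y :* w) := x :* (v :* y :* w)) ≈-refl (x t) (vacancy (above t) u) (x u) (w u)
        ... | true  | false = ≈-trans (zeroˡ _) (≈-sym (zeroʳ _))
        ... | false | _     = zeroˡ _

      expanded : ∀ u → vacancy B u * (x u * w u) ≤ vacancy A u * x u * w u + sum λ t → contribution t u
      expanded u = begin
        vacancy B u * (x u * w u)
          ≤⟨ *-monoˡ-≤ (*-nonNeg (0≤x u) (0≤w u)) (vacancy-expand A↑ B↑ B⊆A u) ⟩
        (vacancy A u + _) * (x u * w u)
          ≈⟨ distribʳ _ _ _ ⟩
        vacancy A u * (x u * w u) + _ * (x u * w u)
          ≈⟨ +-cong (≈-sym (*-assoc _ _ _)) (collect-u u) ⟩
        vacancy A u * x u * w u + (sum λ t → contribution t u)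
          ∎

      unblocked : ∀ {u} → B u ≡ false → vacancy B u ≈ 1#
      unblocked {u} u∉B = product-ones factor
        where
        factor : ∀ s → (if B s ∧ does (w s <? w u) then 1# - x s else 1#) ≈ 1#
        factor s with B s in s∈B | w s <? w u
        ... | true  | yes s<u = contradiction (≡.trans (≡.sym u∉B) (upper-< {B} B↑ s<u s∈B)) (λ ())
        ... | true  | no  _   = ≈-refl
        ... | false | _       = ≈-refl

      pointwise : ∀ u → (if B u then vacancy B u * x u * w u else 0#) + (if (A ∖ B) u then w u * x u else 0#)
                      ≤ (if A u then vacancy A u * x u * w u else 0#) + sum λ t → contribution t u
      pointwise u with A u in u∈A | B u in u∈B
      ... | true  | true  = begin
        vacancy B u * x u * w u + 0# ≈⟨ ≈-trans (+-identityʳ _) (*-assoc _ _ _) ⟩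
        vacancy B u * (x u * w u)    ≤⟨ expanded u ⟩
        _                            ∎
      ... | true  | false = begin
        0# + w u * x u               ≈⟨ solve 2 (λ w x → con (+ 0) :+ w :* x := con (+ 1) :* (x :* w)) ≈-refl (w u) (x u) ⟩
        1# * (x u * w u)             ≈⟨ *-congʳ (unblocked u∈B) ⟨
        vacancy B u * (x u * w u)    ≤⟨ expanded u ⟩
        _                            ∎
      ... | false | true  = contradiction (≡.trans (≡.sym u∈A) (B⊆A u u∈B)) (λ ())
      ... | false | false = +-monoʳ-≤ 0# (sum-nonNeg λ t → 0≤contribution t u)

    -- Deficits of rewards against a common upper bound.

    module Bounded {M : Carrier} (reward≤M : ∀ {A} → Upper A → reward A ≤ M) where
      L : Carrier
      L = value all

      0≤L : 0# ≤ L
      0≤L = 0≤value all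

      all-upper : Upper all
      all-upper _ _ = ≡.refl

      none-upper : Upper none
      none-upper _ ()

      0≤M : 0# ≤ M
      0≤M = ≤-trans (0≤reward all) (reward≤M {all} all-upper)

      deficit : Fin n → Carrier
      deficit t = M - reward (above t)

      0≤deficit : ∀ t → 0# ≤ deficit t
      0≤deficit t = x≤y⇒0≤y-x (reward≤M (above-upper t))

      totalDeficit : Carrier
      totalDeficit = sum λ t → x t * deficit t

      -- The exchange inequality between `all` and `none`, with `reward (above t)` written as
      -- `M - deficit t`. The mass is kept explicit here because the case of small total mass is
      -- excluded by it later.
      totalDeficit+L≤M+M*mass : totalDeficit + L ≤ M + M * mass all
      totalDeficit+L≤M+M*mass = begin
        totalDeficit + L
          ≤⟨ +-monoʳ-≤ totalDeficit L≤ ⟩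
        totalDeficit + (M + rewards)
          ≈⟨ solve 3 (λ d m r → d :+ (m :+ r) := m :+ (d :+ r)) ≈-refl totalDeficit M rewards ⟩
        M + (totalDeficit + rewards)
          ≈⟨ +-congˡ (∑-distrib-+ (λ t → x t * deficit t) (λ t → x t * reward (above t))) ⟨
        M + sum (λ t → x t * deficit t + x t * reward (above t))
          ≈⟨ +-congˡ (sum-cong-≋ λ t →
               solve 3 (λ x m r → x :* (m :- r) :+ x :* r := m :* x) ≈-refl (x t) M (reward (above t))) ⟩
        M + sum (λ t → M * x t)
          ≈⟨ +-congˡ (*-distribˡ-sum M x) ⟨
        M + M * mass all ∎
        where
        rewards = sum λ t → x t * reward (above t)
        L≤ : L ≤ M + rewards
        L≤ = begin
          L                     ≤⟨ ≤-from-gap (0≤reward none) (+-comm _ _) ⟩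
          reward none + L       ≤⟨ reward-exchange {all} {none} all-upper none-upper (λ _ ()) ⟩
          reward all + rewards  ≤⟨ +-monoˡ-≤ rewards (reward≤M {all} all-upper) ⟩
          M + rewards           ∎

      totalDeficit+L≤2M : totalDeficit + L ≤ M + M
      totalDeficit+L≤2M = begin
        totalDeficit + L ≤⟨ totalDeficit+L≤M+M*mass ⟩
        M + M * sum x    ≤⟨ +-monoʳ-≤ M (*-monoʳ-≤ 0≤M ∑x≤1) ⟩
        M + M * 1#       ≈⟨ +-congˡ (*-identityʳ M) ⟩
        M + M            ∎

      0≤totalDeficit : 0# ≤ totalDeficit
      0≤totalDeficit = sum-nonNeg λ t → *-nonNeg (0≤x t) (0≤deficit t)

      L≤2M : L ≤ M + M
      L≤2M = ≤-trans (≤-from-gap 0≤totalDeficit (+-comm _ _)) totalDeficit+L≤2M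

      -- Markov's inequality for the deficit under the measure `x`.
      mass*deficit≤totalDeficit : ∀ {A g} → (∀ t → A t ≡ true → g ≤ deficit t) → mass A * g ≤ totalDeficit
      mass*deficit≤totalDeficit {A} {g} g≤ = begin
        mass A * g                              ≈⟨ *-distribʳ-sum g (λ t → if A t then x t else 0#) ⟩
        sum (λ t → (if A t then x t else 0#) * g) ≤⟨ sum-mono-≤ pointwise ⟩
        totalDeficit                            ∎
        where
        pointwise : ∀ t → (if A t then x t else 0#) * g ≤ x t * deficit t
        pointwise t with A t in t∈A
        ... | true  = *-monoʳ-≤ (0≤x t) (g≤ t t∈A)
        ... | false = ≤-trans (≤-reflexive (zeroˡ g)) (*-nonNeg (0≤x t) (0≤deficit t))

      exchange-bounded : ∀ {A B} → Upper A → Upper B → B ⊆ A → reward B + value (A ∖ B) ≤ M + M * mass (A ∖ B)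
      exchange-bounded {A} {B} A↑ B↑ B⊆A = begin
        reward B + value (A ∖ B)
          ≤⟨ reward-exchange A↑ B↑ B⊆A ⟩
        reward A + sum (λ t → if (A ∖ B) t then x t * reward (above t) else 0#)
          ≤⟨ +-mono-≤ (reward≤M A↑) (sum-mono-≤ pointwise) ⟩
        M + sum (λ t → M * (if (A ∖ B) t then x t else 0#))
          ≈⟨ +-congˡ (*-distribˡ-sum M (λ t → if (A ∖ B) t then x t else 0#)) ⟨
        M + M * mass (A ∖ B)
          ∎
        where
        pointwise : ∀ t → (if (A ∖ B) t then x t * reward (above t) else 0#) ≤ M * (if (A ∖ B) t then x t else 0#)
        pointwise t with (A ∖ B) t
        ... | true  = ≤-trans (*-monoʳ-≤ (0≤x t) (reward≤M (above-upper t))) (≤-reflexive (*-comm (x t) M))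
        ... | false = ≤-reflexive (≈-sym (zeroʳ M))

      -- Elements of weight above a threshold that is at least the row value.

      module Large {τ} (L≤τ : L ≤ τ) where
        T : Event
        T = exceeding τ

        T↑ : Upper T
        T↑ = exceeding-upper τ

        w≤τ-outside : ∀ {t} → T t ≡ false → w t ≤ τ
        w≤τ-outside {t} t∉T with τ <? w t
        ... | no τ≮t = ≮⇒≥ τ≮t

        τ≤w-inside : ∀ {t} → T t ≡ true → τ ≤ w t
        τ≤w-inside {t} t∈T with τ <? w t
        ... | yes τ<t = proj₁ τ<t

        q F : Carrier
        q = mass T
        F = value T

        0≤q : 0# ≤ q
        0≤q = 0≤mass T

        value-large≤ : F ≤ M + M * q
        value-large≤ = begin
          F                        ≈⟨ sum-cong-≋ (λ t → same t (w t * x t)) ⟩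
          value (T ∖ none)         ≤⟨ ≤-from-gap (0≤reward none) (+-comm _ _) ⟩
          reward none + value (T ∖ none) ≤⟨ exchange-bounded T↑ none-upper (λ _ ()) ⟩
          M + M * mass (T ∖ none)  ≈⟨ +-congˡ (*-congˡ (sum-cong-≋ (λ t → same t (x t)))) ⟨
          M + M * q                ∎
          where
          same : ∀ t v → (if T t then v else 0#) ≈ (if (T ∖ none) t then v else 0#)
          same t v with T t
          ... | true  = ≈-refl
          ... | false = ≈-refl

        -- Exchange between `T` and `above t`, which is contained in `T` because `t` is. Each
        -- element of `T ∖ above t` weighs at least `L`, so on balance it forces a deficit of
        -- `L - M` per unit of mass.
        deficit≥-inside : ∀ t → T t ≡ true → (L - M) * mass (T ∖ above t) ≤ deficit t
        deficit≥-inside t t∈T = 0≤y-x⇒x≤y (begin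
          0#
            ≤⟨ x≤y⇒0≤y-x (≤-trans (+-monoʳ-≤ _ L*mass≤value) (exchange-bounded T↑ (above-upper t) above⊆T)) ⟩
          (M + M * m) - (reward (above t) + L * m)
            ≈⟨ solve 4 (λ M m r L → (M :+ M :* m) :- (r :+ L :* m) := (M :- r) :- (L :- M) :* m) ≈-refl M m (reward (above t)) L ⟩
          deficit t - (L - M) * m
            ∎)
          where
          m = mass (T ∖ above t)
          above⊆T : above t ⊆ T
          above⊆T s s∈ with w t <? w s
          ... | yes (t≤s , _) = T↑ t≤s t∈T
          L*mass≤value : L * m ≤ value (T ∖ above t)
          L*mass≤value = ≤-trans (≤-reflexive (*-distribˡ-sum L (λ s → if (T ∖ above t) s then x s else 0#))) (sum-mono-≤ pointwise)
            where
            pointwise : ∀ s → L * (if (T ∖ above t) s then x s else 0#) ≤ (if (T ∖ above t) s then w s * x s else 0#)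
            pointwise s with T s in s∈T | above t s
            ... | true  | true  = ≤-reflexive (zeroʳ L)
            ... | true  | false = *-monoˡ-≤ (0≤x s) (≤-trans L≤τ (τ≤w-inside s∈T))
            ... | false | _     = ≤-reflexive (zeroʳ L)

        -- Bound the reward by the value of `above t`: its part inside `T` is worth at most `F`, and
        -- elements outside `T` weigh at most `τ`.
        deficit≥ : ∀ t → M - F - τ * mass (above t) ≤ deficit t
        deficit≥ t = 0≤y-x⇒x≤y (begin
          0#
            ≤⟨ x≤y⇒0≤y-x (≤-trans (reward≤value (above t)) value≤) ⟩
          (F + τ * m) - reward (above t)
            ≈⟨ solve 4 (λ M F k r → (F :+ k) :- r := (M :- r) :- (M :- F :- k)) ≈-refl M F (τ * m) (reward (above t)) ⟩
          deficit t - (M - F - τ * m) ∎)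
          where
          m = mass (above t)
          pointwise : ∀ s → (if above t s then w s * x s else 0#)
                          ≤ (if T s then w s * x s else 0#) + τ * (if above t s then x s else 0#)
          pointwise s with above t s | T s in s∈T
          ... | true  | true  = x≤x+y _ (*-nonNeg (≤-trans 0≤L L≤τ) (0≤x s))
          ... | true  | false = ≤-trans (*-monoˡ-≤ (0≤x s) (w≤τ-outside s∈T)) (≤-reflexive (≈-sym (+-identityˡ _)))
          ... | false | b     = +-nonNeg (if-nonNeg b (0≤wx s)) (≤-reflexive (≈-sym (zeroʳ τ)))
          value≤ : value (above t) ≤ F + τ * m
          value≤ = begin
            value (above t) ≤⟨ sum-mono-≤ pointwise ⟩
            sum (λ s → (if T s then w s * x s else 0#) + τ * (if above t s then x s else 0#))
              ≈⟨ ∑-distrib-+ (λ s → if T s then w s * x s else 0#) (λ s → τ * (if above t s then x s else 0#)) ⟩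
            F + sum (λ s → τ * (if above t s then x s else 0#))
              ≈⟨ +-congˡ (*-distribˡ-sum τ (λ s → if above t s then x s else 0#)) ⟨
            F + τ * m ∎

        -- For t and s in T, at least one of the masses of T ∖ above t and T ∖ above s
        -- counts the pair {s, t}.
        q²≤ : q * q ≤ (sum λ t → (if T t then x t else 0#) * mass (T ∖ above t))
                    + (sum λ t → (if T t then x t else 0#) * mass (T ∖ above t))
        q²≤ = begin
          q * q
            ≈⟨ *-distribʳ-sum q y ⟩
          sum (λ t → y t * q)
            ≈⟨ sum-cong-≋ (λ t → *-distribˡ-sum (y t) y) ⟩
          sum (λ t → sum λ s → y t * y s)
            ≤⟨ sum-mono-≤ (λ t → sum-mono-≤ (λ s → pointwise t s)) ⟩
          sum (λ t → sum λ s → p t s + p s t)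
            ≈⟨ sum-cong-≋ (λ t → ∑-distrib-+ (p t) (λ s → p s t)) ⟩
          sum (λ t → sum (p t) + sum λ s → p s t)
            ≈⟨ ∑-distrib-+ (λ t → sum (p t)) (λ t → sum λ s → p s t) ⟩
          sum (λ t → sum (p t)) + sum (λ t → sum λ s → p s t)
            ≈⟨ +-congˡ (∑-comm (λ t s → p s t)) ⟩
          sum (λ t → sum (p t)) + sum (λ t → sum (p t))
            ≈⟨ +-cong collect collect ⟩
          _ ∎
          where
          y : Fin n → Carrier
          y t = if T t then x t else 0#
          p : Fin n → Fin n → Carrier
          p t s = y t * (if (T ∖ above t) s then x s else 0#)
          collect : sum (λ t → sum (p t)) ≈ sum λ t → y t * mass (T ∖ above t)
          collect = sum-cong-≋ λ t → ≈-sym (*-distribˡ-sum (y t) λ s → if (T ∖ above t) s then x s else 0#)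
          pointwise : ∀ t s → y t * y s ≤ p t s + p s t
          pointwise t s with T t | T s | w t <? w s | w s <? w t
          ... | false | _     | _       | _       = ≤-trans (≤-reflexive (≈-trans (zeroˡ _) (≈-sym (zeroˡ _)))) (≤-from-gap (*-nonNeg (if-nonNeg _ (0≤x s)) ≤-refl) ≈-refl)
          ... | true  | false | _       | _       = ≤-trans (≤-reflexive (≈-sym (≈-trans (+-congˡ (zeroˡ _)) (+-identityʳ _)))) ≤-refl
          ... | true  | true  | no _    | b       = x≤x+y _ (*-nonNeg (0≤x s) (if-nonNeg (not (does b)) (0≤x t)))
          ... | true  | true  | yes _   | no _    = ≤-reflexive (≈-trans (*-comm _ _) (≈-sym (≈-trans (+-congʳ (zeroʳ _)) (+-identityˡ _))))
          ... | true  | true  | yes t<s | yes s<t = contradiction (<-trans t<s s<t) (<-irrefl ≈-refl)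

        -- Averaging `deficit≥-inside` over `T` with weights `x t` bounds `(L - M) * S` by the total
        -- deficit, and `q²≤` bounds `q * q` by `S + S`.
        [L-M]q²≤ : M ≤ L → (L - M) * (q * q) ≤ totalDeficit + totalDeficit
        [L-M]q²≤ M≤L = begin
          (L - M) * (q * q)
            ≤⟨ *-monoʳ-≤ (x≤y⇒0≤y-x M≤L) q²≤ ⟩
          (L - M) * (S + S)
            ≈⟨ distribˡ (L - M) S S ⟩
          (L - M) * S + (L - M) * S
            ≤⟨ +-mono-≤ [L-M]S≤ [L-M]S≤ ⟩
          totalDeficit + totalDeficit ∎
          where
          S = sum λ t → (if T t then x t else 0#) * mass (T ∖ above t)
          pointwise : ∀ t → (L - M) * ((if T t then x t else 0#) * mass (T ∖ above t)) ≤ x t * deficit t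
          pointwise t with T t in t∈T
          ... | true  = begin
            (L - M) * (x t * mass (T ∖ above t)) ≈⟨ solve 3 (λ l x m → l :* (x :* m) := x :* (l :* m)) ≈-refl (L - M) (x t) (mass (T ∖ above t)) ⟩
            x t * ((L - M) * mass (T ∖ above t)) ≤⟨ *-monoʳ-≤ (0≤x t) (deficit≥-inside t t∈T) ⟩
            x t * deficit t ∎
          ... | false = begin
            (L - M) * (0# * _) ≈⟨ ≈-trans (*-congˡ (zeroˡ _)) (zeroʳ _) ⟩
            0#                 ≤⟨ *-nonNeg (0≤x t) (0≤deficit t) ⟩
            x t * deficit t    ∎
          [L-M]S≤ : (L - M) * S ≤ totalDeficit
          [L-M]S≤ = ≤-trans (≤-reflexive (*-distribˡ-sum (L - M) (λ t → (if T t then x t else 0#) * mass (T ∖ above t)))) (sum-mono-≤ pointwise)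

      -- Rows whose bound is close to half their value.

      module NearTight {ε} (0≤ε : 0# ≤ ε) (10ε≤1 : fromℕ 10 * ε ≤ 1#) (L≰0 : ¬ (L ≤ 0#))
                       (M≤ : M ≤ (½ + ε * ε * ε) * L) {α} (1≤α : 1# ≤ α) where
        open SmallEpsilon 0≤ε 10ε≤1

        L≤αL : L ≤ α * L
        L≤αL = ≤-trans (≤-reflexive (≈-sym (*-identityˡ L))) (*-monoˡ-≤ 0≤L 1≤α)

        open Large L≤αL

        δ : Carrier
        δ = ε * ε * ε

        totalDeficit≤ : totalDeficit ≤ (δ + δ) * L
        totalDeficit≤ = +-cancelʳ-≤ L (begin
          totalDeficit + L                ≤⟨ totalDeficit+L≤2M ⟩
          M + M                           ≤⟨ +-mono-≤ M≤ M≤ ⟩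
          (½ + δ) * L + (½ + δ) * L
            ≈⟨ solve 3 (λ h d L → (h :+ d) :* L :+ (h :+ d) :* L := (d :+ d) :* L :+ (h :+ h) :* L) ≈-refl ½ δ L ⟩
          (δ + δ) * L + (½ + ½) * L       ≈⟨ +-congˡ (≈-trans (*-congʳ 2½≈1) (*-identityˡ L)) ⟩
          (δ + δ) * L + L                 ∎)

        [½-δ]L≤L-M : (½ - δ) * L ≤ L - M
        [½-δ]L≤L-M = 0≤y-x⇒x≤y (begin
          0#                          ≤⟨ x≤y⇒0≤y-x M≤ ⟩
          (½ + δ) * L - M
            ≈⟨ solve 4 (λ h d L M → (h :+ d) :* L :- M := ((h :+ h) :* L :- M) :- (h :- d) :* L) ≈-refl ½ δ L M ⟩
          ((½ + ½) * L - M) - (½ - δ) * L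
            ≈⟨ +-congʳ (+-congʳ (≈-trans (*-congʳ 2½≈1) (*-identityˡ L))) ⟩
          (L - M) - (½ - δ) * L       ∎)

        0≤½-δ : 0# ≤ ½ - δ
        0≤½-δ = ≰⇒≥ ½-ε³≰0

        M≤L : M ≤ L
        M≤L = 0≤y-x⇒x≤y (≤-trans (*-nonNeg 0≤½-δ 0≤L) [½-δ]L≤L-M)

        -- Both sides are squared and scaled by `L * (½ - δ)`. The total deficit contributes `4δL`,
        -- and `4δ` is `4ε` times `ε²`, where `4ε ≤ ½ - δ`.
        q≤ε : q ≤ ε
        q≤ε = x²≤y²⇒x≤y 0≤q 0≤ε (*-cancelˡ-≤ ½-ε³≰0 (*-cancelˡ-≤ L≰0 (begin
          L * ((½ - δ) * (q * q))
            ≈⟨ solve 3 (λ L k q → L :* (k :* q) := k :* L :* q) ≈-refl L (½ - δ) (q * q) ⟩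
          (½ - δ) * L * (q * q)
            ≤⟨ *-monoˡ-≤ (*-nonNeg 0≤q 0≤q) [½-δ]L≤L-M ⟩
          (L - M) * (q * q)
            ≤⟨ [L-M]q²≤ M≤L ⟩
          totalDeficit + totalDeficit
            ≤⟨ +-mono-≤ totalDeficit≤ totalDeficit≤ ⟩
          (δ + δ) * L + (δ + δ) * L
            ≈⟨ solve 2 (λ e L → (e :* e :* e :+ e :* e :* e) :* L :+ (e :* e :* e :+ e :* e :* e) :* L
                             := L :* ((numeral 4 :* e) :* (e :* e))) ≈-refl ε L ⟩
          L * ((fromℕ 4 * ε) * (ε * ε))
            ≤⟨ *-monoʳ-≤ 0≤L (*-monoˡ-≤ 0≤ε² 4ε≤½-ε³) ⟩
          L * ((½ - δ) * (ε * ε))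
            ∎)))

        value-large-upper : F ≤ (½ + ε) * L
        value-large-upper = begin
          F                             ≤⟨ value-large≤ ⟩
          M + M * q                     ≤⟨ +-monoʳ-≤ M (*-monoʳ-≤ 0≤M q≤ε) ⟩
          M + M * ε                     ≈⟨ solve 2 (λ M e → M :+ M :* e := M :* (con (+ 1) :+ e)) ≈-refl M ε ⟩
          M * (1# + ε)                  ≤⟨ *-monoˡ-≤ (+-nonNeg 0≤1 0≤ε) M≤ ⟩
          (½ + δ) * L * (1# + ε)        ≈⟨ solve 3 (λ a L b → a :* L :* b := a :* b :* L) ≈-refl (½ + δ) L (1# + ε) ⟩
          (½ + δ) * (1# + ε) * L        ≤⟨ *-monoˡ-≤ 0≤L [½+ε³][1+ε]≤½+ε ⟩
          (½ + ε) * L                   ∎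

        -- The bound of `deficit≥` with the mass above replaced by `ε * ε`, hence a common lower
        -- bound for the deficits of all elements having no more mass above them.
        gap : Carrier
        gap = M - F - (α * L) * (ε * ε)

        gap≤deficit : ∀ {t} → mass (above t) ≤ ε * ε → gap ≤ deficit t
        gap≤deficit {t} m≤ε² = ≤-trans (0≤y-x⇒x≤y (begin
          0#
            ≤⟨ x≤y⇒0≤y-x (*-monoʳ-≤ (≤-trans 0≤L L≤αL) m≤ε²) ⟩
          (α * L) * (ε * ε) - (α * L) * mass (above t)
            ≈⟨ solve 3 (λ b k m → k :- m := (b :- m) :- (b :- k)) ≈-refl (M - F) ((α * L) * (ε * ε)) ((α * L) * mass (above t)) ⟩
          (M - F - (α * L) * mass (above t)) - gap ∎)) (deficit≥ t)

        -- By Markov, `mass A * gap` is at most `2ε³L`, that is, `ε²` times `2εL`; since `mass A`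
        -- exceeds `ε²`, it can be put in place of `ε²` and cancelled.
        gap≤2εL : ∀ A → ¬ (mass A ≤ ε * ε) → (∀ t → A t ≡ true → gap ≤ deficit t) → gap ≤ (ε + ε) * L
        gap≤2εL A m≰ε² gap≤ = *-cancelˡ-≤ (λ m≤0 → m≰ε² (≤-trans m≤0 0≤ε²)) (begin
          mass A * gap                  ≤⟨ mass*deficit≤totalDeficit {A} gap≤ ⟩
          totalDeficit                ≤⟨ totalDeficit≤ ⟩
          (δ + δ) * L                 ≈⟨ solve 2 (λ e L → (e :* e :* e :+ e :* e :* e) :* L := e :* e :* ((e :+ e) :* L)) ≈-refl ε L ⟩
          ε * ε * ((ε + ε) * L)       ≤⟨ *-monoˡ-≤ (*-nonNeg (+-nonNeg 0≤ε 0≤ε) 0≤L) (≰⇒≥ m≰ε²) ⟩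
          mass A * ((ε + ε) * L)      ∎)

        -- A tiny total mass would bring the factor `2` in `L ≤ 2M` down to `1 + ε²`, too small for
        -- an `M` near half of `L`.
        total-mass≰ε² : ¬ (mass all ≤ ε * ε)
        total-mass≰ε² m≤ε² = 1≰[½+ε³][1+ε²] (*-cancelˡ-≤ L≰0 (begin
          L * 1#                       ≈⟨ *-identityʳ L ⟩
          L                            ≤⟨ ≤-from-gap 0≤totalDeficit (+-comm _ _) ⟩
          totalDeficit + L             ≤⟨ totalDeficit+L≤M+M*mass ⟩
          M + M * mass all             ≤⟨ +-monoʳ-≤ M (*-monoʳ-≤ 0≤M m≤ε²) ⟩
          M + M * (ε * ε)              ≈⟨ solve 2 (λ M e → M :+ M :* e := M :* (con (+ 1) :+ e)) ≈-refl M (ε * ε) ⟩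
          M * (1# + ε * ε)             ≤⟨ *-monoˡ-≤ (+-nonNeg 0≤1 0≤ε²) M≤ ⟩
          (½ + δ) * L * (1# + ε * ε)   ≈⟨ solve 3 (λ a L b → a :* L :* b := L :* (a :* b)) ≈-refl (½ + δ) L (1# + ε * ε) ⟩
          L * ((½ + δ) * (1# + ε * ε)) ∎))

        -- Every element in the heaviest ε² of the mass, up to rounding, has deficit
        -- at least gap.
        gap≤ : gap ≤ (ε + ε) * L
        gap≤ with extremal {P = λ t → mass (above t) ≤ ε * ε} {_≺_ = λ s t → w s < w t}
                  (λ t → mass (above t) ≤? ε * ε) (λ s t → w s <? w t) (<-irrefl ≈-refl) <-trans
        ... | inj₁ light = gap≤2εL all total-mass≰ε² (λ t _ → gap≤deficit (light t))
        -- `t₀` is a heaviest element with more than `ε²` of mass above it. So `above t₀` is heavy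
        -- enough for `gap≤2εL`, while each of its elements has at most `ε²` above it.
        ... | inj₂ (t₀ , m≰ε² , light) = gap≤2εL (above t₀) m≰ε² λ t t∈ → gap≤deficit (light t (above⇒< t t∈))
          where
          above⇒< : ∀ t → above t₀ t ≡ true → w t₀ < w t
          above⇒< t t∈ with w t₀ <? w t
          ... | yes t₀<t = t₀<t

        -- `L≤2M` gives half of `L` below `M`, and `gap≤` bounds `M - F` by
        -- `(ε + ε) * L + (α * L) * (ε * ε)`, which `ε²≤ε` brings to the stated loss.
        value-large-lower : (½ - (α + fromℕ 2) * ε) * L ≤ F
        value-large-lower = double-cancel-≤ (begin
          k + k
            ≈⟨ solve 4 (λ h α e L → (h :- (α :+ numeral 2) :* e) :* L :+ (h :- (α :+ numeral 2) :* e) :* L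
                 := (h :+ h) :* L :- ((α :+ numeral 2) :* e :* L :+ (α :+ numeral 2) :* e :* L)) ≈-refl ½ α ε L ⟩
          (½ + ½) * L - (c + c)
            ≈⟨ +-congʳ (≈-trans (*-congʳ 2½≈1) (*-identityˡ L)) ⟩
          L - (c + c)
            ≤⟨ +-monoˡ-≤ (- (c + c)) L≤2M ⟩
          (M + M) - (c + c)
            ≈⟨ solve 5 (λ M F α e L →
                 (M :+ M) :- ((α :+ numeral 2) :* e :* L :+ (α :+ numeral 2) :* e :* L)
                 := (F :+ F) :+ ((((M :- F) :- (α :* L) :* (e :* e)) :+ ((M :- F) :- (α :* L) :* (e :* e)))
                     :- (((e :+ e) :* L :+ (α :* L) :* (e :- e :* e)) :+ ((e :+ e) :* L :+ (α :* L) :* (e :- e :* e)))))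
                 ≈-refl M F α ε L ⟩
          (F + F) + ((gap + gap) - (r + r))
            ≤⟨ +-monoʳ-≤ (F + F) (+-monoˡ-≤ (- (r + r)) (+-mono-≤ gap≤r gap≤r)) ⟩
          (F + F) + ((r + r) - (r + r))
            ≈⟨ solve 2 (λ f r → f :+ (r :- r) := f) ≈-refl (F + F) (r + r) ⟩
          F + F ∎)
          where
          k = (½ - (α + fromℕ 2) * ε) * L
          c = (α + fromℕ 2) * ε * L
          -- The bound on `gap` is padded so that `r + (α * L) * (ε * ε)` equals `c`.
          r = (ε + ε) * L + (α * L) * (ε - ε * ε)
          gap≤r : gap ≤ r
          gap≤r = ≤-trans gap≤ (x≤x+y _ (*-nonNeg (≤-trans 0≤L L≤αL) (x≤y⇒0≤y-x ε²≤ε)))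

-- From single rows to the whole matrix.

module Decomposition {ℓ} {ℝ : CompleteOrderedField ℓ} (G : Instance ℝ) where
  open CompleteOrderedField ℝ hiding (zero)
  open RealProperties ℝ
  open FieldInequalities ℝ
  open Rows ℝ
  open Instance G
  open OnlineMatching G
  open PartialOrderReasoning poset
  open IntegerCoefficientSolver commutativeRing

  -- With the row as an argument, a case split can replace `ã i` by the kept or the zero row;
  -- `LPᵢ x i` and `large α x i` unfold to these forms.
  rowValue : (V → Carrier) → (V → Carrier) → Carrier
  rowValue w x = sum λ t → w t * x t

  largePart : Carrier → (V → Carrier) → (V → Carrier) → V → Carrier
  largePart α w x t = x t * 𝟙 (α * rowValue w x <? w t)

  LargePartBounds : Carrier → Carrier → (V → Carrier) → (V → Carrier) → Set ℓ
  LargePartBounds ε α w x =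
    sum (largePart α w x) ≤ ε ×
    (½ - (α + fromℕ 2) * ε) * rowValue w x ≤ rowValue w (largePart α w x) ×
    rowValue w (largePart α w x) ≤ (½ + ε) * rowValue w x

  -- The threshold `α * rowValue w x` is zero, so every large element has positive weight; as the
  -- row is worth nothing, its entry there vanishes and the large part is zero.
  worthless-row : ∀ {ε α w x} → 0# ≤ ε → (∀ t → 0# ≤ w t) → (∀ t → 0# ≤ x t) →
                  rowValue w x ≤ 0# → LargePartBounds ε α w x
  worthless-row {ε} {α} {w} {x} 0≤ε 0≤w 0≤x L≤0 =
    ≤-trans (≤-reflexive (sum-zero largePart≈0)) 0≤ε ,
    ≤-reflexive (≈-trans *L≈0 (≈-sym value≈0)) ,
    ≤-reflexive (≈-trans value≈0 (≈-sym *L≈0))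
    where
    0≤wx : ∀ t → 0# ≤ w t * x t
    0≤wx t = *-nonNeg (0≤w t) (0≤x t)
    L≈0 : rowValue w x ≈ 0#
    L≈0 = antisym L≤0 (sum-nonNeg 0≤wx)
    *L≈0 : ∀ {z} → z * rowValue w x ≈ 0#
    *L≈0 = ≈-trans (*-congˡ L≈0) (zeroʳ _)
    largePart≈0 : ∀ t → largePart α w x t ≈ 0#
    largePart≈0 t with α * rowValue w x <? w t
    ... | no  _   = zeroʳ (x t)
    ... | yes τ<w = ≈-trans (*-identityʳ (x t)) (antisym (*-cancelˡ-≤ w≰0 (begin
      w t * x t    ≤⟨ term≤sum 0≤wx t ⟩
      rowValue w x ≤⟨ L≤0 ⟩
      0#           ≈⟨ zeroʳ (w t) ⟨
      w t * 0#     ∎)) (0≤x t))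
      where
      w≰0 : ¬ (w t ≤ 0#)
      w≰0 w≤0 = <⇒≱ τ<w (≤-trans w≤0 (≤-reflexive (≈-sym *L≈0)))
    value≈0 : rowValue w (largePart α w x) ≈ 0#
    value≈0 = sum-zero λ t → ≈-trans (*-congˡ (largePart≈0 t)) (zeroʳ (w t))

  near-tight-row : ∀ {ε α w x M} (0≤w : ∀ t → 0# ≤ w t) (0≤x : ∀ t → 0# ≤ x t) (∑x≤1 : sum x ≤ 1#) →
    (let open Row w x 0≤w 0≤x ∑x≤1) → (∀ {A} → Upper A → reward A ≤ M) →
    0# ≤ ε → fromℕ 10 * ε ≤ 1# → 1# ≤ α → M ≤ (½ + ε * ε * ε) * rowValue w x →
    LargePartBounds ε α w x
  near-tight-row {ε} {α} {w} {x} 0≤w 0≤x ∑x≤1 reward≤M 0≤ε 10ε≤1 1≤α M≤ with rowValue w x ≤? 0#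
  -- The estimates for near-tight rows cancel a factor `L`, so rows of value zero are settled
  -- separately.
  ... | yes L≤0 = worthless-row {α = α} 0≤ε 0≤w 0≤x L≤0
  ... | no  L≰0 =
    ≤-respˡ-≈ (≈-sym mass≈) q≤ε ,
    ≤-respʳ-≈ (≈-sym value≈) value-large-lower ,
    ≤-respˡ-≈ (≈-sym value≈) value-large-upper
    where
    open Row w x 0≤w 0≤x ∑x≤1
    open Bounded reward≤M
    open NearTight 0≤ε 10ε≤1 L≰0 M≤ 1≤α
    mass≈ : sum (largePart α w x) ≈ mass (exceeding (α * L))
    mass≈ = sum-cong-≋ term
      where
      term : ∀ t → largePart α w x t ≈ (if does (α * L <? w t) then x t else 0#)
      term t with α * L <? w t
      ... | yes _ = *-identityʳ (x t)
      ... | no  _ = zeroʳ (x t)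
    value≈ : rowValue w (largePart α w x) ≈ value (exceeding (α * L))
    value≈ = sum-cong-≋ term
      where
      term : ∀ t → w t * largePart α w x t ≈ (if does (α * L <? w t) then w t * x t else 0#)
      term t with α * L <? w t
      ... | yes _ = *-congˡ (*-identityʳ (x t))
      ... | no  _ = ≈-trans (*-congˡ (zeroʳ (x t))) (zeroʳ (w t))

  module _ {a} (a∈𝒫 : 𝒫 a) (i : U) where
    open 𝒫 a∈𝒫
    open Row (w i) (a i) (0≤w i) (nonNeg i) (offline i)

    thresholdValue≤LBᵢ : ∀ {τ} → 0# ≤ τ → thresholdValue a i τ ≤ LBᵢ a i
    thresholdValue≤LBᵢ {τ} 0≤τ = proj₂ (proj₂ (maxThresholdValue a i)) _ (τ , 0≤τ , ≈-refl)

    -- A nonempty upper set consists of the elements weighing at least as much as its lightest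
    -- element `t₀`, so its reward is the threshold sum at `w i t₀`. `extremal` finds `t₀` in the
    -- reversed weight order.
    reward≤LBᵢ : ∀ {A} → Upper A → reward A ≤ LBᵢ a i
    reward≤LBᵢ {A} A↑ with extremal {P = λ t → A t ≡ false} {_≺_ = λ s t → w i t < w i s}
                             (λ t → A t Bool.≟ false) (λ s t → w i t <? w i s)
                             (<-irrefl ≈-refl) (λ t<s u<t → <-trans u<t t<s)
    ... | inj₁ empty = begin
      reward A                ≈⟨ reward-cong {A} {none} empty ⟩
      reward none             ≈⟨ sum-zero {∣V∣} (λ _ → ≈-refl) ⟩
      0#                      ≤⟨ 0≤reward _ ⟩
      thresholdValue a i 0#   ≤⟨ thresholdValue≤LBᵢ ≤-refl ⟩
      LBᵢ a i                 ∎
    ... | inj₂ (t₀ , t₀∈ , below) = begin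
      reward A                     ≈⟨ reward-cong {A} same ⟩
      thresholdValue a i (w i t₀)  ≤⟨ thresholdValue≤LBᵢ (0≤w i t₀) ⟩
      LBᵢ a i                      ∎
      where
      same : ∀ t → A t ≡ does (w i t₀ ≤? w i t)
      same t with w i t₀ ≤? w i t
      ... | yes t₀≤t = A↑ t₀≤t (Bool.¬-not t₀∈)
      ... | no  t₀≰t = below t (≰⇒> t₀≰t)

    ½LPᵢ≤LBᵢ : ½ * LPᵢ a i ≤ LBᵢ a i
    ½LPᵢ≤LBᵢ = double-cancel-≤ (begin
      ½ * LPᵢ a i + ½ * LPᵢ a i ≈⟨ distribʳ (LPᵢ a i) ½ ½ ⟨
      (½ + ½) * LPᵢ a i         ≈⟨ ≈-trans (*-congʳ 2½≈1) (*-identityˡ _) ⟩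
      LPᵢ a i                   ≤⟨ Bounded.L≤2M reward≤LBᵢ ⟩
      LBᵢ a i + LBᵢ a i         ∎)

  -- Dropping the rows that are far from tight.

  module Truncation {ε a} (0≤ε : 0# ≤ ε) (10ε≤1 : fromℕ 10 * ε ≤ 1#) (a∈𝒫 : 𝒫 a)
                    (LB≤ : LB a ≤ (½ + ε * ε * ε * ε) * LP a) where
    open 𝒫 a∈𝒫
    open SmallEpsilon 0≤ε 10ε≤1

    δ : Carrier
    δ = ε * ε * ε

    tight? : ∀ i → Dec (LBᵢ a i ≤ (½ + δ) * LPᵢ a i)
    tight? i = LBᵢ a i ≤? (½ + δ) * LPᵢ a i

    -- Rows are kept or dropped whole, so a kept row retains its `LPᵢ` and hence its threshold for
    -- large elements.
    ã : U → V → Carrier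
    ã i = if does (tight? i) then a i else λ _ → 0#

    0≤ã : ∀ i t → 0# ≤ ã i t
    0≤ã i t with tight? i
    ... | yes _ = nonNeg i t
    ... | no  _ = ≤-refl

    ã≤a : ∀ i t → ã i t ≤ a i t
    ã≤a i t with tight? i
    ... | yes _ = ≤-refl
    ... | no  _ = nonNeg i t

    ã-bounds : ∀ {α} → 1# ≤ α → ∀ i → LargePartBounds ε α (w i) (ã i)
    ã-bounds {α} 1≤α i with tight? i
    ... | yes LBᵢ≤ = near-tight-row (0≤w i) (nonNeg i) (offline i) (reward≤LBᵢ a∈𝒫 i) 0≤ε 10ε≤1 1≤α LBᵢ≤
    ... | no  _    = worthless-row {α = α} 0≤ε (0≤w i) (λ _ → ≤-refl) (≤-reflexive (sum-zero λ t → zeroʳ (w i t)))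

    lostᵢ : U → Carrier
    lostᵢ i = if does (tight? i) then 0# else LPᵢ a i

    lost : Carrier
    lost = sum lostᵢ

    LP-split : LP a ≈ LP ã + lost
    LP-split = ≈-trans (sum-cong-≋ row) (∑-distrib-+ (LPᵢ ã) lostᵢ)
      where
      row : ∀ i → LPᵢ a i ≈ LPᵢ ã i + lostᵢ i
      row i with tight? i
      ... | yes _ = ≈-sym (+-identityʳ _)
      ... | no  _ = ≈-sym (≈-trans (+-congʳ (sum-zero λ t → zeroʳ (w i t))) (+-identityˡ _))

    -- Every row has `LBᵢ` at least half of `LPᵢ`, and a dropped row exceeds this by `δ * LPᵢ`; the
    -- total excess is at most `ε⁴` of `LP a`. The factor `δ` stays because it may be zero.
    δ*lost≤δ*εLP : δ * lost ≤ δ * (ε * LP a)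
    δ*lost≤δ*εLP = +-cancelˡ-≤ (½ * LP a) (begin
      ½ * LP a + δ * lost
        ≈⟨ sum-linear ½ δ (LPᵢ a) lostᵢ ⟩
      sum (λ i → ½ * LPᵢ a i + δ * lostᵢ i)
        ≤⟨ sum-mono-≤ row ⟩
      LB a
        ≤⟨ LB≤ ⟩
      (½ + ε * ε * ε * ε) * LP a
        ≈⟨ solve 3 (λ h e L → (h :+ e :* e :* e :* e) :* L := h :* L :+ e :* e :* e :* (e :* L)) ≈-refl ½ ε (LP a) ⟩
      ½ * LP a + δ * (ε * LP a) ∎)
      where
      row : ∀ i → ½ * LPᵢ a i + δ * lostᵢ i ≤ LBᵢ a i
      row i with tight? i
      ... | yes _    = ≤-trans (≤-reflexive (≈-trans (+-congˡ (zeroʳ δ)) (+-identityʳ _))) (½LPᵢ≤LBᵢ a∈𝒫 i)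
      ... | no  LBᵢ≰ = ≤-trans (≤-reflexive (≈-sym (distribʳ (LPᵢ a i) ½ δ))) (≰⇒≥ LBᵢ≰)

    excess : U → Carrier
    excess i = LBᵢ a i - ½ * LPᵢ a i

    -- Handles `ε = 0`, where `δ` cannot be cancelled: the non-negative excesses sum to at most
    -- zero, so each of them vanishes and no row is dropped.
    all-tight : ε ≤ 0# → ∀ i → LBᵢ a i ≤ (½ + δ) * LPᵢ a i
    all-tight ε≤0 i = ≤-trans (0≤y-x⇒x≤y (begin
      0#                            ≈⟨ solve 2 (λ b l → con (+ 0) := (l :- b) :+ (b :- l)) ≈-refl (LBᵢ a i) (½ * LPᵢ a i) ⟩
      (½ * LPᵢ a i - LBᵢ a i) + excess i ≤⟨ +-monoʳ-≤ _ excess≤0 ⟩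
      (½ * LPᵢ a i - LBᵢ a i) + 0#  ≈⟨ +-identityʳ _ ⟩
      ½ * LPᵢ a i - LBᵢ a i         ∎))
      (*-monoˡ-≤ (sum-nonNeg λ t → *-nonNeg (0≤w i t) (nonNeg i t)) (x≤x+y ½ 0≤ε³))
      where
      ε≈0 : ε ≈ 0#
      ε≈0 = antisym ε≤0 0≤ε
      ∑excess : sum excess + ½ * LP a ≈ LB a
      ∑excess = begin-equality
        sum excess + ½ * LP a                       ≈⟨ +-congˡ (*-distribˡ-sum ½ (LPᵢ a)) ⟩
        sum excess + sum (λ j → ½ * LPᵢ a j)        ≈⟨ ∑-distrib-+ excess (λ j → ½ * LPᵢ a j) ⟨
        sum (λ j → excess j + ½ * LPᵢ a j)          ≈⟨ sum-cong-≋ (λ j → x-y+y≈x (LBᵢ a j) (½ * LPᵢ a j)) ⟩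
        LB a                                        ∎
      excess≤0 : excess i ≤ 0#
      excess≤0 = ≤-trans (term≤sum (λ j → x≤y⇒0≤y-x (½LPᵢ≤LBᵢ a∈𝒫 j)) i) (+-cancelʳ-≤ (½ * LP a) (begin
        sum excess + ½ * LP a        ≈⟨ ∑excess ⟩
        LB a                         ≤⟨ LB≤ ⟩
        (½ + ε * ε * ε * ε) * LP a   ≈⟨ *-congʳ (+-congˡ (≈-trans (*-congˡ ε≈0) (zeroʳ _))) ⟩
        (½ + 0#) * LP a              ≈⟨ *-congʳ (+-identityʳ ½) ⟩
        ½ * LP a                     ≈⟨ +-identityˡ _ ⟨
        0# + ½ * LP a                ∎))

    0≤LP : 0# ≤ LP a
    0≤LP = sum-nonNeg λ i → sum-nonNeg λ t → *-nonNeg (0≤w i t) (nonNeg i t)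

    lost≤εLP : lost ≤ ε * LP a
    lost≤εLP with ε ≤? 0#
    ... | yes ε≤0 = ≤-trans (≤-reflexive (sum-zero nothing-lost)) (*-nonNeg 0≤ε 0≤LP)
      where
      nothing-lost : ∀ i → lostᵢ i ≈ 0#
      nothing-lost i with tight? i
      ... | yes _    = ≈-refl
      ... | no  LBᵢ≰ = contradiction (all-tight ε≤0 i) LBᵢ≰
    ... | no  ε≰0 = *-cancelˡ-≤ (positive (positive ε≰0 ε≰0) ε≰0) δ*lost≤δ*εLP
      where
      positive : ∀ {x y} → ¬ (x ≤ 0#) → ¬ (y ≤ 0#) → ¬ (x * y ≤ 0#)
      positive {x} x≰0 y≰0 xy≤0 = y≰0 (*-cancelˡ-≤ x≰0 (≤-trans xy≤0 (≤-reflexive (≈-sym (zeroʳ x)))))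

    LPã≥ : (1# - ε) * LP a ≤ LP ã
    LPã≥ = +-cancelʳ-≤ lost (begin
      (1# - ε) * LP a + lost         ≤⟨ +-monoʳ-≤ _ lost≤εLP ⟩
      (1# - ε) * LP a + ε * LP a     ≈⟨ solve 2 (λ e L → (con (+ 1) :- e) :* L :+ e :* L := L) ≈-refl ε (LP a) ⟩
      LP a                           ≈⟨ LP-split ⟩
      LP ã + lost                    ∎)

lemma4p2 : ∀ {ℓ} (ℝ : CompleteOrderedField ℓ) (G : Instance ℝ) →
    let open CompleteOrderedField ℝ
        open RealProperties ℝ using (fourthRoot)
        open Instance G
        open OnlineMatching G
    in (γ α : Carrier) (0≤γ : 0# ≤ γ) → γ < 10⁻⁴ → 1# ≤ α →
    let γ^¼ = proj₁ (fourthRoot γ 0≤γ)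
    in (a : U → V → Carrier) → 𝒫 a → LB a ≤ (½ + γ) * LP a →
    ∃ λ (ã : U → V → Carrier) →
      (∀ i t → 0# ≤ ã i t) ×
      (∀ i t → ã i t ≤ a i t) ×
      (1# - γ^¼) * LP a ≤ LP ã ×
      (∀ i →
        let ãᴸ = large α ã
        in sum (λ t → ãᴸ i t) ≤ γ^¼ ×
           (½ - (α + fromℕ 2) * γ^¼) * LPᵢ ã i ≤ LPᵢ ãᴸ i ×
           LPᵢ ãᴸ i ≤ (½ + γ^¼) * LPᵢ ã i)
lemma4p2 ℝ G γ α 0≤γ γ<10⁻⁴ 1≤α a a∈𝒫 LB≤ = ã , 0≤ã , ã≤a , LPã≥ , ã-bounds 1≤α
  where
  open CompleteOrderedField ℝ
  open RealProperties ℝ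
  open FieldInequalities ℝ using (ε⁴≤10⁻⁴⇒10ε≤1)
  open IntegerCoefficientSolver commutativeRing
  open OnlineMatching G
  root = fourthRoot γ 0≤γ
  ε = proj₁ root
  0≤ε = proj₁ (proj₂ root)
  ε⁴≈γ = proj₂ (proj₂ root)
  -- `ε ^ 4` unfolds to a right-nested product ending in `1#`; the truncation is stated with the
  -- left-nested product extending `δ`.
  γ≈ : γ ≈ ε * ε * ε * ε
  γ≈ = ≈-trans (≈-sym ε⁴≈γ)
    (solve 1 (λ e → e :* (e :* (e :* (e :* con (+ 1)))) := e :* e :* e :* e) ≈-refl ε)
  open Decomposition.Truncation G 0≤ε
    (ε⁴≤10⁻⁴⇒10ε≤1 0≤ε (≤-respˡ-≈ (≈-sym ε⁴≈γ) (proj₁ γ<10⁻⁴))) a∈𝒫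
    (≤-respʳ-≈ (*-congʳ (+-congˡ γ≈)) LB≤)
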